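{- Let $n, m \geq 1$ and let $\lambda_{n,1},\dots,\lambda_{n,n}$ be the roots of $q_n(x)$. Then $$\prod_{i = 1}^n q_m (\lambda_{n,i}) = \begin{cases} 0 & \text{if } \gcd(n+1,m+1) \neq 1,\\ (-1)^{nm/2} & \text{if } \gcd(n+1,m+1) = 1.\end{cases}$$
   Context: The path $P_n$ is the graph with vertex set $[n]=\{1,\dots,n\}$ and edges $\{i,i+1\}$ for $i \in [n-1]$. For $n \ge 1$, $q_n(x)=\det(\mathbf{A}(P_n)-x\mathbf{I}_n)$, where $\mathbf{A}(P_n)$ is the adjacency matrix of $P_n$ (a polynomial of degree $n$); by convention $q_0(x)=1$. The roots $\lambda_{n,1},\dots,\lambda_{n,n}$ are listed with multiplicity. -}

module Defs where

open import Level using (Level)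
open import Data.Nat using (ℕ; zero; suc)
open import Data.Fin using (Fin; zero; suc; toℕ; punchIn)
open import Data.List using (List; []; _∷_; map; foldr)
open import Data.Bool using (Bool; true; false; if_then_else_; _∨_)
open import Relation.Nullary.Decidable using (⌊_⌋)
open import Algebra.Bundles using (CommutativeRing)
import Data.Nat as N

module DetOver {a : Level} {A : Set a}
  (_⊕_ _⊗_ : A → A → A) (⊖_ : A → A) (zeroA oneA : A) where

  signA : ℕ → A
  signA zero    = oneA
  signA (suc k) = ⊖ signA k

  sumFin : {n : ℕ} → (Fin n → A) → A
  sumFin {zero}  f = zeroA
  sumFin {suc n} f = f zero ⊕ sumFin (λ i → f (suc i))

  det : (n : ℕ) → (Fin n → Fin n → A) → A
  det zero    M = oneA
  det (suc n) M =
    sumFin (λ j → (signA (toℕ j) ⊗ M zero j)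
                    ⊗ det n (λ i k → M (suc i) (punchIn j k)))

-- Adjacency relation of the path P_n on vertices 0..n-1 (i.e. 1..n shifted):
-- i ~ j iff |i - j| = 1.
pathAdj : {n : ℕ} → Fin n → Fin n → Bool
pathAdj i j = ⌊ toℕ i N.≟ suc (toℕ j) ⌋ ∨ ⌊ toℕ j N.≟ suc (toℕ i) ⌋

diag : {n : ℕ} → Fin n → Fin n → Bool
diag i j = ⌊ toℕ i N.≟ toℕ j ⌋

module PathPoly {c ℓ : Level} (R : CommutativeRing c ℓ) where
  open CommutativeRing R using (Carrier; _+_; _*_; -_; 0#; 1#; _≈_)

  minusOnePow : ℕ → Carrier
  minusOnePow zero    = 1#
  minusOnePow (suc k) = - minusOnePow k

  -- univariate polynomials over R as coefficient lists, lowest degree first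
  Poly : Set c
  Poly = List Carrier

  padd : Poly → Poly → Poly
  padd []      q       = q
  padd (x ∷ p) []      = x ∷ p
  padd (x ∷ p) (y ∷ q) = (x + y) ∷ padd p q

  pneg : Poly → Poly
  pneg = map (-_)

  pmul : Poly → Poly → Poly
  pmul []      q = []
  pmul (x ∷ p) q = padd (map (x *_) q) (0# ∷ pmul p q)

  pconst : Carrier → Poly
  pconst x = x ∷ []

  pX : Poly
  pX = 0# ∷ 1# ∷ []

  coeff : Poly → ℕ → Carrier
  coeff []      k       = 0#
  coeff (x ∷ p) zero    = x
  coeff (x ∷ p) (suc k) = coeff p k

  _≈ₚ_ : Poly → Poly → Set ℓ
  p ≈ₚ q = ∀ k → coeff p k ≈ coeff q k

  eval : Poly → Carrier → Carrier
  eval p t = foldr (λ a acc → a + t * acc) 0# p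

  prodFin : {n : ℕ} → (Fin n → Carrier) → Carrier
  prodFin {zero}  f = 1#
  prodFin {suc n} f = f zero * prodFin (λ i → f (suc i))

  pprodFin : {n : ℕ} → (Fin n → Poly) → Poly
  pprodFin {zero}  f = pconst 1#
  pprodFin {suc n} f = pmul (f zero) (pprodFin (λ i → f (suc i)))

  b2r : Bool → Carrier
  b2r true  = 1#
  b2r false = 0#

  adjP : (n : ℕ) → Fin n → Fin n → Carrier
  adjP n i j = b2r (pathAdj i j)

  charMat : (n : ℕ) → Fin n → Fin n → Poly
  charMat n i j = padd (pconst (adjP n i j))
                       (if diag i j then pneg pX else [])

  open DetOver padd pmul pneg [] (pconst 1#) public
    renaming (det to pdet)

  q : ℕ → Poly
  q n = pdet n (charMat n)

module Submission where

-- Put cheb y n = U_n(y / 2), so that q_n(x) = cheb (- x) n and the numbers ν_i = - λ_i are the roots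
-- of the monic polynomial cheb X n.  The product R(n, m) = ∏_i cheb (ν_i) m is evaluated by the
-- Euclidean algorithm on (n + 1, m + 1).  At a root of cheb X n one has
-- cheb (n + 1 + k) = cheb (n + 1) * cheb k, which lowers m; the factor
-- R(n, n + 1) = (-1)^n R(n, n - 1) is found by induction on n.  If m < n, let μ_j be the roots of
-- cheb X m in an extension ring; then R(n, m) = ∏_i ∏_j (ν_i - μ_j) = (-1)^(n m) R(m, n).  Since the
-- base ring is arbitrary, the extension is built by adjoining roots one at a time, passing from A to
-- A[X] / (g); as g is monic, A embeds into the quotient, so identities descend.

open import Defs
open import Level using (Level; _⊔_) renaming (suc to lsuc)
open import Algebra.Bundles using (CommutativeRing; CommutativeMonoid)
import Algebra.Morphism.Construct.Composition as Composition
open import Algebra.Morphism.Structures using (IsRingHomomorphism)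
import Algebra.Properties.CommutativeMonoid.Sum as Sum
import Algebra.Properties.CommutativeSemigroup as CommutativeSemigroupProperties
import Algebra.Properties.Ring as RingProperties
import Algebra.Solver.Ring.NaturalCoefficients.Default as SemiringSolver
open import Data.Bool using (_∨_; if_then_else_)
open import Data.Fin using (Fin; zero; suc; toℕ; punchIn)
open import Data.List using ([]; _∷_; map; foldr)
import Data.List.Properties as List
open import Data.Nat as ℕ using (ℕ; zero; suc; z≤n; s≤s; _≤_; _<_)
open import Data.Nat.Divisibility
  using (_∣_; divides; _∣0; ∣-refl; ∣-antisym; ∣1⇒≡1; ∣m∣n⇒∣m+n; ∣m+n∣m⇒∣n; ∣m⇒∣m*n; ∣n⇒∣m*n)
open import Data.Nat.DivMod using (_/_; +-distrib-/-∣ˡ; m*n/n≡m)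
open import Data.Nat.GCD using (gcd; gcd-greatest; gcd[m,n]∣m; gcd[m,n]∣n; gcd-comm)
import Data.Nat.Properties as ℕ
open import Data.Product using (_×_; _,_; proj₁; proj₂)
open import Data.Sum using (_⊎_; inj₁; inj₂)
open import Function using (_∘_; id)
open import Relation.Binary.PropositionalEquality as ≡ using (_≡_; _≢_)
import Relation.Binary.Reasoning.Setoid as SetoidReasoning
open import Relation.Nullary using (yes; no; contradiction)
open import Relation.Nullary.Decidable using (⌊_⌋; isYes≗does)

-- Only the roots of `q n` are given; `q m` need not split over the base ring, and this is what
-- forces the ring extensions. Each exchange of n and m therefore also replaces the ring, so every
-- inductive statement quantifies over all rings and all universe levels. The signs close up for two
-- reasons. In the lowering step, n (n + 1 + k) / 2 = n (n + 1) / 2 + n k / 2, with the same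
-- rounding on both sides because n (n + 1) is even, so the factor contributed by R(n, n + 1) has to
-- be the sign with the triangular exponent n (n + 1) / 2. In the exchange step the sign (-1)^(n m)
-- is invisible: if n and m are both odd, then n + 1 and m + 1 share the factor 2 and both products
-- vanish, and otherwise n m is even. Passing to the negated roots makes the polynomials monic,
-- which serves both the product formula and the embedding into the quotient.

-- Coefficient lists as a commutative ring

module PolynomialRing {c ℓ : Level} (R : CommutativeRing c ℓ) where
  open CommutativeRing R
  open PathPoly R public
  open RingProperties ring using (-0#≈0#)

  -- A record, unlike the bare family _≈ₚ_, lets Agda infer p and q.
  infix 4 _≋_
  record _≋_ (p q : Poly) : Set ℓ where
    constructor coeffwise
    field coeff≈ : p ≈ₚ q
  open _≋_ public

  ≋-refl : ∀ {p} → p ≋ p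
  ≋-refl = coeffwise λ _ → refl

  ≋-sym : ∀ {p q} → p ≋ q → q ≋ p
  ≋-sym p≋q = coeffwise λ k → sym (coeff≈ p≋q k)

  ≋-trans : ∀ {p q r} → p ≋ q → q ≋ r → p ≋ r
  ≋-trans p≋q q≋r = coeffwise λ k → trans (coeff≈ p≋q k) (coeff≈ q≋r k)

  ∷-cong : ∀ {x y p q} → x ≈ y → p ≋ q → (x ∷ p) ≋ (y ∷ q)
  ∷-cong x≈y p≋q = coeffwise λ where
    zero    → x≈y
    (suc k) → coeff≈ p≋q k

  0∷[]≋[] : (0# ∷ []) ≋ []
  0∷[]≋[] = coeffwise λ where
    zero    → refl
    (suc _) → refl

  scale : Carrier → Poly → Poly
  scale x = map (x *_)

  coeff-padd : ∀ p q k → coeff (padd p q) k ≈ coeff p k + coeff q k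
  coeff-padd []      q       k       = sym (+-identityˡ _)
  coeff-padd (x ∷ p) []      k       = sym (+-identityʳ _)
  coeff-padd (x ∷ p) (y ∷ q) zero    = refl
  coeff-padd (x ∷ p) (y ∷ q) (suc k) = coeff-padd p q k

  coeff-pneg : ∀ p k → coeff (pneg p) k ≈ - coeff p k
  coeff-pneg []      k       = sym -0#≈0#
  coeff-pneg (x ∷ p) zero    = refl
  coeff-pneg (x ∷ p) (suc k) = coeff-pneg p k

  coeff-scale : ∀ x p k → coeff (scale x p) k ≈ x * coeff p k
  coeff-scale x []      k       = sym (zeroʳ x)
  coeff-scale x (y ∷ p) zero    = refl
  coeff-scale x (y ∷ p) (suc k) = coeff-scale x p k

  padd-cong : ∀ {p p′ q q′} → p ≋ p′ → q ≋ q′ → padd p q ≋ padd p′ q′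
  padd-cong {p} {p′} {q} {q′} p≋p′ q≋q′ = coeffwise λ k →
    trans (coeff-padd p q k)
      (trans (+-cong (coeff≈ p≋p′ k) (coeff≈ q≋q′ k)) (sym (coeff-padd p′ q′ k)))

  padd-comm : ∀ p q → padd p q ≋ padd q p
  padd-comm p q = coeffwise λ k →
    trans (coeff-padd p q k) (trans (+-comm _ _) (sym (coeff-padd q p k)))

  padd-assoc : ∀ p q r → padd (padd p q) r ≋ padd p (padd q r)
  padd-assoc p q r = coeffwise λ k →
    trans (coeff-padd (padd p q) r k)
      (trans (+-congʳ (coeff-padd p q k))
        (trans (+-assoc _ _ _)
          (trans (+-congˡ (sym (coeff-padd q r k))) (sym (coeff-padd p (padd q r) k)))))

  padd-identityʳ : ∀ p → padd p [] ≋ p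
  padd-identityʳ []      = ≋-refl
  padd-identityʳ (x ∷ p) = ≋-refl

  pneg-cong : ∀ {p q} → p ≋ q → pneg p ≋ pneg q
  pneg-cong {p} {q} p≋q = coeffwise λ k →
    trans (coeff-pneg p k) (trans (-‿cong (coeff≈ p≋q k)) (sym (coeff-pneg q k)))

  padd-inverseˡ : ∀ p → padd (pneg p) p ≋ []
  padd-inverseˡ p = coeffwise λ k →
    trans (coeff-padd (pneg p) p k) (trans (+-congʳ (coeff-pneg p k)) (-‿inverseˡ _))

  padd-inverseʳ : ∀ p → padd p (pneg p) ≋ []
  padd-inverseʳ p = ≋-trans (padd-comm p (pneg p)) (padd-inverseˡ p)

  padd-commutativeMonoid : CommutativeMonoid c ℓ
  padd-commutativeMonoid = record
    { Carrier = Poly ; _≈_ = _≋_ ; _∙_ = padd ; ε = []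
    ; isCommutativeMonoid = record
      { isMonoid = record
        { isSemigroup = record
          { isMagma = record
            { isEquivalence = record { refl = ≋-refl ; sym = ≋-sym ; trans = ≋-trans }
            ; ∙-cong = padd-cong }
          ; assoc = padd-assoc }
        ; identity = (λ _ → ≋-refl) , padd-identityʳ }
      ; comm = padd-comm } }

  open CommutativeSemigroupProperties (CommutativeMonoid.commutativeSemigroup padd-commutativeMonoid)
    using () renaming (interchange to padd-interchange; x∙yz≈y∙xz to padd-leftComm)
  open SetoidReasoning (CommutativeMonoid.setoid padd-commutativeMonoid)

  scale-cong : ∀ {x y p q} → x ≈ y → p ≋ q → scale x p ≋ scale y q
  scale-cong {x} {y} {p} {q} x≈y p≋q = coeffwise λ k →
    trans (coeff-scale x p k) (trans (*-cong x≈y (coeff≈ p≋q k)) (sym (coeff-scale y q k)))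

  scale-zero : ∀ p → scale 0# p ≋ []
  scale-zero p = coeffwise λ k → trans (coeff-scale 0# p k) (zeroˡ _)

  scale-one : ∀ p → scale 1# p ≋ p
  scale-one p = coeffwise λ k → trans (coeff-scale 1# p k) (*-identityˡ _)

  scale-padd : ∀ x p q → scale x (padd p q) ≋ padd (scale x p) (scale x q)
  scale-padd x p q = coeffwise λ k →
    trans (coeff-scale x (padd p q) k)
      (trans (*-congˡ (coeff-padd p q k))
        (trans (distribˡ x _ _)
          (trans (sym (+-cong (coeff-scale x p k) (coeff-scale x q k)))
            (sym (coeff-padd (scale x p) (scale x q) k)))))

  scale-* : ∀ x y p → scale (x * y) p ≋ scale x (scale y p)
  scale-* x y p = coeffwise λ k →
    trans (coeff-scale (x * y) p k)
      (trans (*-assoc x y _)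
        (trans (*-congˡ (sym (coeff-scale y p k))) (sym (coeff-scale x (scale y p) k))))

  0∷-padd : ∀ p q → (0# ∷ padd p q) ≋ padd (0# ∷ p) (0# ∷ q)
  0∷-padd p q = ∷-cong (sym (+-identityˡ 0#)) ≋-refl

  pmul-congˡ : ∀ p {q q′} → q ≋ q′ → pmul p q ≋ pmul p q′
  pmul-congˡ []      q≋q′ = ≋-refl
  pmul-congˡ (x ∷ p) q≋q′ =
    padd-cong (scale-cong refl q≋q′) (∷-cong refl (pmul-congˡ p q≋q′))

  pmul-zeroʳ : ∀ p → pmul p [] ≋ []
  pmul-zeroʳ []      = ≋-refl
  pmul-zeroʳ (x ∷ p) = ≋-trans (∷-cong refl (pmul-zeroʳ p)) 0∷[]≋[]

  pmul-distribˡ : ∀ p q r → pmul p (padd q r) ≋ padd (pmul p q) (pmul p r)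
  pmul-distribˡ []      q r = ≋-refl
  pmul-distribˡ (x ∷ p) q r = begin
    padd (scale x (padd q r)) (0# ∷ pmul p (padd q r))
      ≈⟨ padd-cong (scale-padd x q r)
           (≋-trans (∷-cong refl (pmul-distribˡ p q r)) (0∷-padd (pmul p q) (pmul p r))) ⟩
    padd (padd (scale x q) (scale x r)) (padd (0# ∷ pmul p q) (0# ∷ pmul p r))
      ≈⟨ padd-interchange (scale x q) (scale x r) (0# ∷ pmul p q) (0# ∷ pmul p r) ⟩
    padd (padd (scale x q) (0# ∷ pmul p q)) (padd (scale x r) (0# ∷ pmul p r)) ∎

  -- The mirror image of the defining clause of `pmul`; commutativity follows from it by induction.
  pmul-∷ʳ : ∀ p y q → pmul p (y ∷ q) ≋ padd (scale y p) (0# ∷ pmul p q)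
  pmul-∷ʳ []      y q = ≋-sym 0∷[]≋[]
  pmul-∷ʳ (x ∷ p) y q = ∷-cong (+-congʳ (*-comm x y)) (begin
    padd (scale x q) (pmul p (y ∷ q))
      ≈⟨ padd-cong ≋-refl (pmul-∷ʳ p y q) ⟩
    padd (scale x q) (padd (scale y p) (0# ∷ pmul p q))
      ≈⟨ padd-leftComm (scale x q) (scale y p) (0# ∷ pmul p q) ⟩
    padd (scale y p) (padd (scale x q) (0# ∷ pmul p q)) ∎)

  pmul-comm : ∀ p q → pmul p q ≋ pmul q p
  pmul-comm []      q = ≋-sym (pmul-zeroʳ q)
  pmul-comm (x ∷ p) q =
    ≋-trans (padd-cong ≋-refl (∷-cong refl (pmul-comm p q))) (≋-sym (pmul-∷ʳ q x p))

  -- Congruence in the left factor is reduced to the right one by commutativity: `pmul` recurses on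
  -- its left list, and equal polynomials may be lists of different lengths.
  pmul-cong : ∀ {p p′ q q′} → p ≋ p′ → q ≋ q′ → pmul p q ≋ pmul p′ q′
  pmul-cong {p} {p′} {q} {q′} p≋p′ q≋q′ = begin
    pmul p q   ≈⟨ pmul-congˡ p q≋q′ ⟩
    pmul p q′  ≈⟨ pmul-comm p q′ ⟩
    pmul q′ p  ≈⟨ pmul-congˡ q′ p≋p′ ⟩
    pmul q′ p′ ≈⟨ pmul-comm q′ p′ ⟩
    pmul p′ q′ ∎

  pmul-distribʳ : ∀ p q r → pmul (padd q r) p ≋ padd (pmul q p) (pmul r p)
  pmul-distribʳ p q r = begin
    pmul (padd q r) p          ≈⟨ pmul-comm (padd q r) p ⟩
    pmul p (padd q r)          ≈⟨ pmul-distribˡ p q r ⟩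
    padd (pmul p q) (pmul p r) ≈⟨ padd-cong (pmul-comm p q) (pmul-comm p r) ⟩
    padd (pmul q p) (pmul r p) ∎

  scale-pmul : ∀ x p q → pmul (scale x p) q ≋ scale x (pmul p q)
  scale-pmul x []      q = ≋-refl
  scale-pmul x (y ∷ p) q = begin
    padd (scale (x * y) q) (0# ∷ pmul (scale x p) q)
      ≈⟨ padd-cong (scale-* x y q) (∷-cong (sym (zeroʳ x)) (scale-pmul x p q)) ⟩
    padd (scale x (scale y q)) (scale x (0# ∷ pmul p q))
      ≈⟨ scale-padd x (scale y q) (0# ∷ pmul p q) ⟨
    scale x (padd (scale y q) (0# ∷ pmul p q)) ∎

  0∷-pmul : ∀ p q → pmul (0# ∷ p) q ≋ (0# ∷ pmul p q)
  0∷-pmul p q = padd-cong (scale-zero q) ≋-refl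

  pmul-assoc : ∀ p q r → pmul (pmul p q) r ≋ pmul p (pmul q r)
  pmul-assoc []      q r = ≋-refl
  pmul-assoc (x ∷ p) q r = begin
    pmul (padd (scale x q) (0# ∷ pmul p q)) r
      ≈⟨ pmul-distribʳ r (scale x q) (0# ∷ pmul p q) ⟩
    padd (pmul (scale x q) r) (pmul (0# ∷ pmul p q) r)
      ≈⟨ padd-cong (scale-pmul x q r)
           (≋-trans (0∷-pmul (pmul p q) r) (∷-cong refl (pmul-assoc p q r))) ⟩
    padd (scale x (pmul q r)) (0# ∷ pmul p (pmul q r)) ∎

  pmul-identityˡ : ∀ p → pmul (pconst 1#) p ≋ p
  pmul-identityˡ p = begin
    padd (scale 1# p) (0# ∷ []) ≈⟨ padd-cong (scale-one p) 0∷[]≋[] ⟩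
    padd p []                   ≈⟨ padd-identityʳ p ⟩
    p                           ∎

  R[X] : CommutativeRing c ℓ
  R[X] = record
    { Carrier = Poly ; _≈_ = _≋_ ; _+_ = padd ; _*_ = pmul ; -_ = pneg ; 0# = [] ; 1# = pconst 1#
    ; isCommutativeRing = record
      { isRing = record
        { +-isAbelianGroup = record
          { isGroup = record
            { isMonoid = CommutativeMonoid.isMonoid padd-commutativeMonoid
            ; inverse = padd-inverseˡ , padd-inverseʳ
            ; ⁻¹-cong = pneg-cong }
          ; comm = padd-comm }
        ; *-cong = pmul-cong
        ; *-assoc = pmul-assoc
        ; *-identity = pmul-identityˡ
                     , λ p → ≋-trans (pmul-comm p (pconst 1#)) (pmul-identityˡ p)
        ; distrib = pmul-distribˡ , pmul-distribʳ }
      ; *-comm = pmul-comm } }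

  pX* : ∀ p → pmul pX p ≋ (0# ∷ p)
  pX* p = ≋-trans (0∷-pmul (pconst 1#) p) (∷-cong refl (pmul-identityˡ p))

  pconst-+-0∷ : ∀ x p → padd (pconst x) (0# ∷ p) ≋ (x ∷ p)
  pconst-+-0∷ x p = ∷-cong (+-identityʳ x) ≋-refl

  ∷-split : ∀ x p → (x ∷ p) ≋ padd (pconst x) (pmul pX p)
  ∷-split x p = ≋-sym (≋-trans (padd-cong (≋-refl {pconst x}) (pX* p)) (pconst-+-0∷ x p))

-- Ring homomorphisms and evaluation of polynomials

-- A record over the bundles, so that R and S can be inferred from a homomorphism.
record IsHom {a b c d : Level} (R : CommutativeRing a b) (S : CommutativeRing c d)
             (f : CommutativeRing.Carrier R → CommutativeRing.Carrier S) : Set (a ⊔ b ⊔ d) where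
  constructor isHom
  field
    isRingHomomorphism : IsRingHomomorphism (CommutativeRing.rawRing R) (CommutativeRing.rawRing S) f
  open IsRingHomomorphism isRingHomomorphism public

module _ {a b c d : Level} {R : CommutativeRing a b} {S : CommutativeRing c d} where
  private
    module R = CommutativeRing R
    module S = CommutativeRing S

  -- Zero and negatives come for free: `f R.0#` is its own double, and `f (R.- x)` is an additive
  -- inverse of `f x`.
  mkIsHom : {f : R.Carrier → S.Carrier} →
    (∀ {x y} → x R.≈ y → f x S.≈ f y) →
    (∀ x y → f (x R.+ y) S.≈ f x S.+ f y) →
    (∀ x y → f (x R.* y) S.≈ f x S.* f y) →
    f R.1# S.≈ S.1# → IsHom R S f
  mkIsHom {f} f-cong f-+ f-* f-1 = isHom record
    { isSemiringHomomorphism = record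
      { isNearSemiringHomomorphism = record
        { +-isMonoidHomomorphism = record
          { isMagmaHomomorphism = record
            { isRelHomomorphism = record { cong = f-cong }
            ; homo = f-+ }
          ; ε-homo = f-0 }
        ; *-homo = f-* }
      ; 1#-homo = f-1 }
    ; -‿homo = λ x → RingProperties.+-inverseʳ-unique S.ring (f x) (f (R.- x))
        (S.trans (S.sym (f-+ x (R.- x))) (S.trans (f-cong (R.-‿inverseʳ x)) f-0)) }
    where
    f-0 : f R.0# S.≈ S.0#
    f-0 = RingProperties.x+x≈x⇒x≈0 S.ring (f R.0#)
      (S.trans (S.sym (f-+ R.0# R.0#)) (f-cong (R.+-identityˡ R.0#)))

  isHom-≗ : {f g : R.Carrier → S.Carrier} → (∀ x → g x S.≈ f x) → IsHom R S f → IsHom R S g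
  isHom-≗ g≗f f-hom = mkIsHom
    (λ {x} {y} x≈y → S.trans (g≗f x) (S.trans (F.⟦⟧-cong x≈y) (S.sym (g≗f y))))
    (λ x y → S.trans (g≗f _) (S.trans (F.+-homo x y) (S.sym (S.+-cong (g≗f x) (g≗f y)))))
    (λ x y → S.trans (g≗f _) (S.trans (F.*-homo x y) (S.sym (S.*-cong (g≗f x) (g≗f y)))))
    (S.trans (g≗f _) F.1#-homo)
    where module F = IsHom f-hom

id-isHom : ∀ {a b} (R : CommutativeRing a b) → IsHom R R id
id-isHom R = mkIsHom id (λ _ _ → refl) (λ _ _ → refl) refl
  where open CommutativeRing R hiding (zero)

∘-isHom : ∀ {a b c d e f} {R : CommutativeRing a b} {S : CommutativeRing c d} {T : CommutativeRing e f} {φ ψ} →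
  IsHom R S φ → IsHom S T ψ → IsHom R T (ψ ∘ φ)
∘-isHom {T = T} (isHom φ-hom) (isHom ψ-hom) =
  isHom (Composition.isRingHomomorphism (CommutativeRing.trans T) φ-hom ψ-hom)

module _ {a b c d : Level} {R : CommutativeRing a b} {S : CommutativeRing c d}
         {φ : CommutativeRing.Carrier R → CommutativeRing.Carrier S} (φ-hom : IsHom R S φ)
         (t : CommutativeRing.Carrier S) where
  private module R = CommutativeRing R
  open CommutativeRing S hiding (zero)
  open IsHom φ-hom
  open PolynomialRing R
  open CommutativeSemigroupProperties +-commutativeSemigroup using (interchange)
  open CommutativeSemigroupProperties *-commutativeSemigroup using (x∙yz≈y∙xz)
  open SetoidReasoning setoid

  -- Horner evaluation along a coefficient homomorphism. With `φ = id` it is definitionally `eval`;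
  -- with `φ = pconst` it is substitution of a polynomial for X.
  aeval : Poly → Carrier
  aeval = foldr (λ x acc → φ x + t * acc) 0#

  private
    aeval-≋[] : ∀ p → p ≋ [] → aeval p ≈ 0#
    aeval-≋[] []      _   = refl
    aeval-≋[] (x ∷ p) p≋0 = begin
      φ x + t * aeval p ≈⟨ +-cong (trans (⟦⟧-cong (coeff≈ p≋0 zero)) 0#-homo)
                             (*-congˡ (aeval-≋[] p (coeffwise λ k → coeff≈ p≋0 (suc k)))) ⟩
      0# + t * 0#       ≈⟨ trans (+-identityˡ _) (zeroʳ t) ⟩
      0#                ∎

    aeval-cong : ∀ p q → p ≋ q → aeval p ≈ aeval q
    aeval-cong []      q       p≋q = sym (aeval-≋[] q (≋-sym p≋q))
    aeval-cong (x ∷ p) []      p≋q = aeval-≋[] (x ∷ p) p≋q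
    aeval-cong (x ∷ p) (y ∷ q) p≋q =
      +-cong (⟦⟧-cong (coeff≈ p≋q zero))
        (*-congˡ (aeval-cong p q (coeffwise λ k → coeff≈ p≋q (suc k))))

    aeval-padd : ∀ p q → aeval (padd p q) ≈ aeval p + aeval q
    aeval-padd []      q       = sym (+-identityˡ _)
    aeval-padd (x ∷ p) []      = sym (+-identityʳ _)
    aeval-padd (x ∷ p) (y ∷ q) = begin
      φ (x R.+ y) + t * aeval (padd p q)
        ≈⟨ +-cong (+-homo x y) (trans (*-congˡ (aeval-padd p q)) (distribˡ t _ _)) ⟩
      (φ x + φ y) + (t * aeval p + t * aeval q)
        ≈⟨ interchange (φ x) (φ y) _ _ ⟩
      (φ x + t * aeval p) + (φ y + t * aeval q) ∎

    aeval-scale : ∀ x p → aeval (scale x p) ≈ φ x * aeval p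
    aeval-scale x []      = sym (zeroʳ _)
    aeval-scale x (y ∷ p) = begin
      φ (x R.* y) + t * aeval (scale x p)
        ≈⟨ +-cong (*-homo x y) (trans (*-congˡ (aeval-scale x p)) (x∙yz≈y∙xz t (φ x) _)) ⟩
      φ x * φ y + φ x * (t * aeval p)
        ≈⟨ distribˡ (φ x) _ _ ⟨
      φ x * (φ y + t * aeval p) ∎

    aeval-pmul : ∀ p q → aeval (pmul p q) ≈ aeval p * aeval q
    aeval-pmul []      q = sym (zeroˡ _)
    aeval-pmul (x ∷ p) q = begin
      aeval (padd (scale x q) (R.0# ∷ pmul p q))
        ≈⟨ aeval-padd (scale x q) (R.0# ∷ pmul p q) ⟩
      aeval (scale x q) + (φ R.0# + t * aeval (pmul p q))
        ≈⟨ +-cong (aeval-scale x q) (trans (+-congʳ 0#-homo) (+-identityˡ _)) ⟩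
      φ x * aeval q + t * aeval (pmul p q)
        ≈⟨ +-congˡ (trans (*-congˡ (aeval-pmul p q)) (sym (*-assoc t _ _))) ⟩
      φ x * aeval q + (t * aeval p) * aeval q
        ≈⟨ distribʳ _ _ _ ⟨
      (φ x + t * aeval p) * aeval q ∎

  aeval-pconst : ∀ x → aeval (pconst x) ≈ φ x
  aeval-pconst x = trans (+-congˡ (zeroʳ t)) (+-identityʳ _)

  aeval-isHom : IsHom R[X] S aeval
  aeval-isHom = mkIsHom (λ {p} {q} → aeval-cong p q) aeval-padd aeval-pmul
    (trans (aeval-pconst R.1#) 1#-homo)

  aeval-X : aeval pX ≈ t
  aeval-X = begin
    φ R.0# + t * aeval (pconst R.1#) ≈⟨ +-cong 0#-homo (*-congˡ (trans (aeval-pconst R.1#) 1#-homo)) ⟩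
    0# + t * 1#                      ≈⟨ trans (+-identityˡ _) (*-identityʳ t) ⟩
    t                                ∎

pconst-isHom : ∀ {a b} (R : CommutativeRing a b) →
  IsHom R (PolynomialRing.R[X] R) (PathPoly.pconst R)
pconst-isHom R = mkIsHom (λ x≈y → ∷-cong x≈y ≋-refl) (λ _ _ → ≋-refl)
  (λ _ _ → ∷-cong (sym (+-identityʳ _)) ≋-refl) ≋-refl
  where
  open CommutativeRing R hiding (zero)
  open PolynomialRing R

-- Mapping the coefficients is evaluation at X of the target polynomial ring.
map-isHom : ∀ {a b c d} {R : CommutativeRing a b} {S : CommutativeRing c d} {φ} → IsHom R S φ →
  IsHom (PolynomialRing.R[X] R) (PolynomialRing.R[X] S) (map φ)
map-isHom {R = R} {S} {φ} φ-hom = isHom-≗ map≋aeval (aeval-isHom φ[X]-hom pX)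
  where
  open PolynomialRing S
  open IsHom φ-hom using (⟦⟧-cong)
  φ[X]-hom : IsHom R R[X] (λ x → pconst (φ x))
  φ[X]-hom = ∘-isHom φ-hom (pconst-isHom S)
  map≋aeval : ∀ p → map φ p ≋ aeval φ[X]-hom pX p
  map≋aeval []      = ≋-refl
  map≋aeval (x ∷ p) = ≋-trans (∷-split (φ x) (map φ p))
    (padd-cong {pconst (φ x)} ≋-refl (pmul-congˡ pX (map≋aeval p)))

coeff-map : ∀ {a b c d} {R : CommutativeRing a b} {S : CommutativeRing c d} {φ} → IsHom R S φ →
  ∀ p k → let open CommutativeRing S using (_≈_) in
  PathPoly.coeff S (map φ p) k ≈ φ (PathPoly.coeff R p k)
coeff-map {S = S} φ-hom []      k       = CommutativeRing.sym S (IsHom.0#-homo φ-hom)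
coeff-map {S = S} φ-hom (x ∷ p) zero    = CommutativeRing.refl S
coeff-map {R = R} {S} φ-hom (x ∷ p) (suc k) = coeff-map φ-hom p k

-- Chebyshev recurrence, signs and finite products

module Chebyshev {c ℓ : Level} (R : CommutativeRing c ℓ) where
  open CommutativeRing R hiding (zero)
  open PathPoly R using (minusOnePow)
  open RingProperties ring using (-‿distribˡ-*; -‿distribʳ-*; -‿involutive; -0#≈0#; ⁻¹-anti-homo‿-)
  open Sum *-commutativeMonoid public using ()
    renaming (sum to ∏; sum-cong-≋ to ∏-cong; ∑-comm to ∏-comm; ∑-distrib-+ to ∏-distrib-*)
  open SetoidReasoning setoid

  -- The Chebyshev polynomial U_n evaluated at y / 2, so that q_n(x) = cheb (- x) n.
  cheb : Carrier → ℕ → Carrier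
  cheb y zero          = 1#
  cheb y (suc zero)    = y
  cheb y (suc (suc n)) = y * cheb y (suc n) - cheb y n

  cheb-cong : ∀ {x y} → x ≈ y → ∀ n → cheb x n ≈ cheb y n
  cheb-cong x≈y zero          = refl
  cheb-cong x≈y (suc zero)    = x≈y
  cheb-cong x≈y (suc (suc n)) =
    +-cong (*-cong x≈y (cheb-cong x≈y (suc n))) (-‿cong (cheb-cong x≈y n))

  -- Both sides satisfy the same three-term recurrence in `k`, so agreement at `k = 0` and `k = 1`
  -- suffices; at `k = 1` the subtracted term is `cheb y n`, which vanishes.
  cheb-shift : ∀ y n → cheb y n ≈ 0# → ∀ k →
    cheb y (suc n ℕ.+ k) ≈ cheb y (suc n) * cheb y k
  cheb-shift y n root zero = begin
    cheb y (suc n ℕ.+ 0) ≡⟨ ≡.cong (cheb y) (ℕ.+-identityʳ (suc n)) ⟩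
    cheb y (suc n)              ≈⟨ *-identityʳ _ ⟨
    cheb y (suc n) * 1#         ∎
  cheb-shift y n root (suc zero) = begin
    cheb y (suc n ℕ.+ 1)      ≡⟨ ≡.cong (cheb y) (ℕ.+-comm (suc n) 1) ⟩
    y * cheb y (suc n) - cheb y n    ≈⟨ +-congˡ (trans (-‿cong root) -0#≈0#) ⟩
    y * cheb y (suc n) + 0#          ≈⟨ trans (+-identityʳ _) (*-comm y _) ⟩
    cheb y (suc n) * y               ∎
  cheb-shift y n root (suc (suc k)) = begin
    cheb y (suc n ℕ.+ suc (suc k))
      ≡⟨ ≡.cong (cheb y) (≡.trans (ℕ.+-suc (suc n) (suc k)) (≡.cong suc (ℕ.+-suc (suc n) k))) ⟩
    y * cheb y (suc (suc n ℕ.+ k)) - cheb y (suc n ℕ.+ k)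
      ≈⟨ +-cong (*-congˡ (trans (reflexive (≡.cong (cheb y) (≡.sym (ℕ.+-suc (suc n) k))))
                                (cheb-shift y n root (suc k))))
                (-‿cong (cheb-shift y n root k)) ⟩
    y * (u * cheb y (suc k)) - u * cheb y k
      ≈⟨ +-cong (x∙yz≈y∙xz y u _) (-‿distribʳ-* u _) ⟩
    u * (y * cheb y (suc k)) + u * - cheb y k
      ≈⟨ distribˡ u _ _ ⟨
    u * cheb y (suc (suc k)) ∎
    where
    open CommutativeSemigroupProperties *-commutativeSemigroup using (x∙yz≈y∙xz)
    u = cheb y (suc n)

  sgn-+ : ∀ a b → minusOnePow (a ℕ.+ b) ≈ minusOnePow a * minusOnePow b
  sgn-+ zero    b = sym (*-identityˡ _)
  sgn-+ (suc a) b = trans (-‿cong (sgn-+ a b)) (-‿distribˡ-* _ _)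

  sgn-double : ∀ a → minusOnePow (a ℕ.+ a) ≈ 1#
  sgn-double zero    = refl
  sgn-double (suc a) = begin
    - minusOnePow (a ℕ.+ suc a) ≡⟨ ≡.cong (λ k → - minusOnePow k) (ℕ.+-suc a a) ⟩
    - - minusOnePow (a ℕ.+ a)   ≈⟨ -‿involutive _ ⟩
    minusOnePow (a ℕ.+ a)       ≈⟨ sgn-double a ⟩
    1#                                 ∎

  ∏-vanishes : ∀ {n} (f : Fin n → Carrier) i → f i ≈ 0# → ∏ f ≈ 0#
  ∏-vanishes f zero    fi≈0 = trans (*-congʳ fi≈0) (zeroˡ _)
  ∏-vanishes f (suc i) fi≈0 = trans (*-congˡ (∏-vanishes (f ∘ suc) i fi≈0)) (zeroʳ _)

  ∏-const : ∀ n e → ∏ {n} (λ _ → minusOnePow e) ≈ minusOnePow (n ℕ.* e)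
  ∏-const zero    e = refl
  ∏-const (suc n) e = trans (*-congˡ (∏-const n e)) (sym (sgn-+ e (n ℕ.* e)))

  ∏-neg : ∀ {n} (f : Fin n → Carrier) → ∏ (λ i → - f i) ≈ minusOnePow n * ∏ f
  ∏-neg {zero}  f = sym (*-identityˡ _)
  ∏-neg {suc n} f = begin
    - f zero * ∏ (λ i → - f (suc i))         ≈⟨ *-congˡ (∏-neg (f ∘ suc)) ⟩
    - f zero * (minusOnePow n * ∏ (f ∘ suc)) ≈⟨ x∙yz≈y∙xz _ _ _ ⟩
    minusOnePow n * (- f zero * ∏ (f ∘ suc)) ≈⟨ *-congˡ (-‿distribˡ-* _ _) ⟨
    minusOnePow n * - ∏ f                    ≈⟨ -‿distribʳ-* _ _ ⟨
    - (minusOnePow n * ∏ f)                  ≈⟨ -‿distribˡ-* _ _ ⟩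
    - minusOnePow n * ∏ f                    ∎
    where open CommutativeSemigroupProperties *-commutativeSemigroup using (x∙yz≈y∙xz)

  -- Reversing all n m differences produces the sign, and the two products commute. This is the
  -- antisymmetry of the resultant of two split monic polynomials.
  ∏-reciprocity : ∀ {n m} (ν : Fin n → Carrier) (μ : Fin m → Carrier) →
    ∏ (λ i → ∏ (λ j → ν i - μ j)) ≈
    minusOnePow (n ℕ.* m) * ∏ (λ j → ∏ (λ i → μ j - ν i))
  ∏-reciprocity {n} {m} ν μ = begin
    ∏ (λ i → ∏ (λ j → ν i - μ j))
      ≈⟨ ∏-cong (λ i → trans (∏-cong (λ j → sym (⁻¹-anti-homo‿- (μ j) (ν i)))) (∏-neg (λ j → μ j - ν i))) ⟩
    ∏ (λ i → minusOnePow m * ∏ (λ j → μ j - ν i))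
      ≈⟨ ∏-distrib-* {n} (λ _ → minusOnePow m) (λ i → ∏ (λ j → μ j - ν i)) ⟩
    ∏ {n} (λ _ → minusOnePow m) * ∏ (λ i → ∏ (λ j → μ j - ν i))
      ≈⟨ *-cong (∏-const n m) (∏-comm (λ i j → μ j - ν i)) ⟩
    minusOnePow (n ℕ.* m) * ∏ (λ j → ∏ (λ i → μ j - ν i)) ∎

module _ {a b c d : Level} {R : CommutativeRing a b} {S : CommutativeRing c d}
         {φ : CommutativeRing.Carrier R → CommutativeRing.Carrier S} (φ-hom : IsHom R S φ) where
  open CommutativeRing S hiding (zero)
  open IsHom φ-hom
  private
    module R = CommutativeRing R
    module CR = Chebyshev R
    module CS = Chebyshev S

  homo-sub : ∀ x y → φ (x R.- y) ≈ φ x - φ y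
  homo-sub x y = trans (+-homo x (R.- y)) (+-congˡ (-‿homo y))

  homo-∏ : ∀ {n} (f : Fin n → R.Carrier) → φ (CR.∏ f) ≈ CS.∏ (φ ∘ f)
  homo-∏ {zero}  f = 1#-homo
  homo-∏ {suc n} f = trans (*-homo _ _) (*-congˡ (homo-∏ (f ∘ suc)))

  homo-cheb : ∀ y n → φ (CR.cheb y n) ≈ CS.cheb (φ y) n
  homo-cheb y zero          = 1#-homo
  homo-cheb y (suc zero)    = refl
  homo-cheb y (suc (suc n)) = trans (homo-sub _ _)
    (+-cong (trans (*-homo _ _) (*-congˡ (homo-cheb y (suc n)))) (-‿cong (homo-cheb y n)))

  homo-sgn : ∀ n → φ (PathPoly.minusOnePow R n) ≈ PathPoly.minusOnePow S n
  homo-sgn zero    = 1#-homo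
  homo-sgn (suc n) = trans (-‿homo _) (-‿cong (homo-sgn n))

-- Quotient by a principal ideal

module Quotient {c ℓ : Level} (R : CommutativeRing c ℓ) (g : CommutativeRing.Carrier R) where
  open CommutativeRing R
  open RingProperties ring using (-‿distribˡ-*; -‿+-comm)
  open SemiringSolver commutativeSemiring using (solve; _:=_; _:+_; _:*_)
  open SetoidReasoning setoid

  infix 4 _∼_
  -- The cofactor is kept as data, since injectivity of the embedding is proved by showing that it
  -- vanishes. Storing it raises the level of equality to `c ⊔ ℓ`.
  record _∼_ (x y : Carrier) : Set (c ⊔ ℓ) where
    constructor differsBy
    field
      quotient : Carrier
      equality : x ≈ y + quotient * g

  ≈⇒∼ : ∀ {x y} → x ≈ y → x ∼ y
  ≈⇒∼ x≈y = differsBy 0# (trans x≈y (sym (trans (+-congˡ (zeroˡ g)) (+-identityʳ _))))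

  ∼-sym : ∀ {x y} → x ∼ y → y ∼ x
  ∼-sym {x} {y} (differsBy h x≈y+hg) = differsBy (- h) (sym (begin
    x + - h * g               ≈⟨ +-cong x≈y+hg (sym (-‿distribˡ-* h g)) ⟩
    (y + h * g) + - (h * g)   ≈⟨ +-assoc y _ _ ⟩
    y + (h * g + - (h * g))   ≈⟨ +-congˡ (-‿inverseʳ _) ⟩
    y + 0#                    ≈⟨ +-identityʳ y ⟩
    y                         ∎))

  ∼-trans : ∀ {x y z} → x ∼ y → y ∼ z → x ∼ z
  ∼-trans {z = z} (differsBy h x≈y+hg) (differsBy k y≈z+kg) = differsBy (k + h)
    (trans x≈y+hg (trans (+-congʳ y≈z+kg)
      (solve 4 (λ z k h g → (z :+ k :* g) :+ h :* g := z :+ (k :+ h) :* g) refl z k h g)))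

  ∼-+-cong : ∀ {x y u v} → x ∼ y → u ∼ v → x + u ∼ y + v
  ∼-+-cong {y = y} {v = v} (differsBy h x≈y+hg) (differsBy k u≈v+kg) = differsBy (h + k)
    (trans (+-cong x≈y+hg u≈v+kg)
      (solve 5 (λ y v k h g → (y :+ h :* g) :+ (v :+ k :* g) := (y :+ v) :+ (h :+ k) :* g)
        refl y v k h g))

  ∼-*-cong : ∀ {x y u v} → x ∼ y → u ∼ v → x * u ∼ y * v
  ∼-*-cong {y = y} {v = v} (differsBy h x≈y+hg) (differsBy k u≈v+kg) =
    differsBy (y * k + h * (v + k * g))
      (trans (*-cong x≈y+hg u≈v+kg)
        (solve 5 (λ y v k h g → (y :+ h :* g) :* (v :+ k :* g)
                              := y :* v :+ (y :* k :+ h :* (v :+ k :* g)) :* g)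
          refl y v k h g))

  ∼-neg-cong : ∀ {x y} → x ∼ y → - x ∼ - y
  ∼-neg-cong {x} {y} (differsBy h x≈y+hg) = differsBy (- h) (begin
    - x               ≈⟨ -‿cong x≈y+hg ⟩
    - (y + h * g)     ≈⟨ -‿+-comm y (h * g) ⟨
    - y + - (h * g)   ≈⟨ +-congˡ (-‿distribˡ-* h g) ⟩
    - y + - h * g     ∎)

  R/⟨g⟩ : CommutativeRing c (c ⊔ ℓ)
  R/⟨g⟩ = record
    { Carrier = Carrier ; _≈_ = _∼_ ; _+_ = _+_ ; _*_ = _*_ ; -_ = -_ ; 0# = 0# ; 1# = 1#
    ; isCommutativeRing = record
      { isRing = record
        { +-isAbelianGroup = record
          { isGroup = record
            { isMonoid = record
              { isSemigroup = record
                { isMagma = record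
                  { isEquivalence = record { refl = ≈⇒∼ refl ; sym = ∼-sym ; trans = ∼-trans }
                  ; ∙-cong = ∼-+-cong }
                ; assoc = λ x y z → ≈⇒∼ (+-assoc x y z) }
              ; identity = (λ x → ≈⇒∼ (+-identityˡ x)) , λ x → ≈⇒∼ (+-identityʳ x) }
            ; inverse = (λ x → ≈⇒∼ (-‿inverseˡ x)) , λ x → ≈⇒∼ (-‿inverseʳ x)
            ; ⁻¹-cong = ∼-neg-cong }
          ; comm = λ x y → ≈⇒∼ (+-comm x y) }
        ; *-cong = ∼-*-cong
        ; *-assoc = λ x y z → ≈⇒∼ (*-assoc x y z)
        ; *-identity = (λ x → ≈⇒∼ (*-identityˡ x)) , λ x → ≈⇒∼ (*-identityʳ x)
        ; distrib = (λ x y z → ≈⇒∼ (distribˡ x y z)) , λ x y z → ≈⇒∼ (distribʳ x y z) }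
      ; *-comm = λ x y → ≈⇒∼ (*-comm x y) } }

  projection-isHom : IsHom R R/⟨g⟩ id
  projection-isHom =
    mkIsHom ≈⇒∼ (λ _ _ → ≈⇒∼ refl) (λ _ _ → ≈⇒∼ refl) (≈⇒∼ refl)

  g∼0 : g ∼ 0#
  g∼0 = differsBy 1# (sym (trans (+-identityˡ _) (*-identityˡ g)))

-- Monic polynomials and synthetic division

module _ {c ℓ : Level} (R : CommutativeRing c ℓ) where
  open CommutativeRing R
  open SemiringSolver commutativeSemiring using (solve; _:=_; _:+_; _:*_)

  -- The induction step of division by X - t, with `x` = X, `s` = X - t, quotient `d` and remainder
  -- `e`. Writing X as `s + t` keeps subtraction out, so that the semiring solver applies.
  horner-step : ∀ x s t a d e → x ≈ s + t →
    a + x * (s * d + e) ≈ s * (e + x * d) + (a + t * e)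
  horner-step x s t a d e x≈s+t =
    trans (+-congˡ (*-congʳ x≈s+t))
      (trans
        (solve 5 (λ s t a d e → a :+ (s :+ t) :* (s :* d :+ e)
                              := s :* (e :+ (s :+ t) :* d) :+ (a :+ t :* e))
          refl s t a d e)
        (sym (+-congʳ (*-congˡ (+-congˡ (*-congʳ x≈s+t))))))

module MonicPolynomials {c ℓ : Level} (R : CommutativeRing c ℓ) where
  open CommutativeRing R hiding (zero)
  open RingProperties ring using (-0#≈0#)
  open PolynomialRing R
  open Chebyshev R[X] using (cheb)
  private module R[X] = CommutativeRing R[X]

  -- Degree is expressed through coefficients: lists may end in zeros, and equality in `R` need not
  -- be decidable.
  record Monic (m : ℕ) (p : Poly) : Set ℓ where
    field
      leading : coeff p m ≈ 1#
      above   : ∀ k → m < k → coeff p k ≈ 0#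
  open Monic public

  coeff-pmul-∷ : ∀ x p q k →
    coeff (pmul (x ∷ p) q) k ≈ x * coeff q k + coeff (0# ∷ pmul p q) k
  coeff-pmul-∷ x p q k =
    trans (coeff-padd (scale x q) (0# ∷ pmul p q) k) (+-congʳ (coeff-scale x q k))

  -- A nonzero multiple of `g` would have degree at least m. Without access to a top coefficient of
  -- the cofactor, the induction peels off its constant term `x`: above degree m, `x` times `g`
  -- contributes nothing, so the tail satisfies the same hypothesis and vanishes; then `x` itself is
  -- the coefficient of degree m.
  monic-cancel : ∀ {m g} → Monic m g → ∀ h →
    (∀ k → m ≤ k → coeff (pmul h g) k ≈ 0#) → h ≋ []
  monic-cancel         monic []      hg-small = ≋-refl
  monic-cancel {m} {g} monic (x ∷ h) hg-small = ≋-trans (∷-cong x≈0 h≋[]) 0∷[]≋[]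
    where
    open SetoidReasoning setoid
    h≋[] : h ≋ []
    h≋[] = monic-cancel monic h λ k m≤k → begin
      coeff (pmul h g) k
        ≈⟨ trans (+-congʳ (zeroʳ x)) (+-identityˡ _) ⟨
      x * 0# + coeff (pmul h g) k
        ≈⟨ +-congʳ (*-congˡ (above monic (suc k) (s≤s m≤k))) ⟨
      x * coeff g (suc k) + coeff (pmul h g) k
        ≈⟨ coeff-pmul-∷ x h g (suc k) ⟨
      coeff (pmul (x ∷ h) g) (suc k)
        ≈⟨ hg-small (suc k) (ℕ.m≤n⇒m≤1+n m≤k) ⟩
      0# ∎
    0∷hg≋[] : (0# ∷ pmul h g) ≋ []
    0∷hg≋[] = ≋-trans (∷-cong refl (pmul-cong {h} {[]} {g} h≋[] ≋-refl)) 0∷[]≋[]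
    x≈0 : x ≈ 0#
    x≈0 = begin
      x                                        ≈⟨ trans (+-identityʳ _) (*-identityʳ x) ⟨
      x * 1# + 0#                              ≈⟨ +-cong (*-congˡ (leading monic)) (coeff≈ 0∷hg≋[] m) ⟨
      x * coeff g m + coeff (0# ∷ pmul h g) m  ≈⟨ coeff-pmul-∷ x h g m ⟨
      coeff (pmul (x ∷ h) g) m                 ≈⟨ hg-small m ℕ.≤-refl ⟩
      0#                                       ∎

  monic-step : ∀ {n p q} → Monic (suc n) p → Monic n q →
    Monic (suc (suc n)) (padd (pmul pX p) (pneg q))
  monic-step {n} {p} {q} p-monic q-monic = record
    { leading = coeff-step (suc n) (leading p-monic) (ℕ.m<n⇒m<1+n ℕ.≤-refl)
    ; above   = λ where
        (suc k) (s≤s n+1<k) → coeff-step k (above p-monic k n+1<k)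
                                (ℕ.m<n⇒m<1+n (ℕ.<-trans ℕ.≤-refl n+1<k)) }
    where
    open SetoidReasoning setoid
    coeff-step : ∀ {x} k → coeff p k ≈ x → n < suc k →
      coeff (padd (pmul pX p) (pneg q)) (suc k) ≈ x
    coeff-step {x} k pₖ≈x n<1+k = begin
      coeff (padd (pmul pX p) (pneg q)) (suc k)
        ≈⟨ coeff-padd (pmul pX p) (pneg q) (suc k) ⟩
      coeff (pmul pX p) (suc k) + coeff (pneg q) (suc k)
        ≈⟨ +-cong (trans (coeff≈ (pX* p) (suc k)) pₖ≈x)
             (trans (coeff-pneg q (suc k))
               (trans (-‿cong (above q-monic (suc k) n<1+k)) -0#≈0#)) ⟩
      x + 0# ≈⟨ +-identityʳ x ⟩
      x ∎

  cheb-monic : ∀ n → Monic n (cheb pX n)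
  cheb-monic zero          = record { leading = refl ; above = λ where (suc k) _ → refl }
  cheb-monic (suc zero)    = record
    { leading = refl
    ; above   = λ where
        (suc (suc k)) _         → refl
        (suc zero)    (s≤s ()) }
  cheb-monic (suc (suc n)) = monic-step (cheb-monic (suc n)) (cheb-monic n)

  linear : Carrier → Poly
  linear t = padd pX (pneg (pconst t))

  module _ (t : Carrier) where
    private
      ev : Poly → Carrier
      ev = aeval (id-isHom R) t
      module Ev = IsHom (aeval-isHom (id-isHom R) t)

    -- The intermediate values of Horner's scheme at `t` are the coefficients of the quotient by X -
    -- t.
    syntheticQuotient : Poly → Poly
    syntheticQuotient []      = []
    syntheticQuotient (x ∷ p) = ev p ∷ syntheticQuotient p

    synthetic-division : ∀ p →
      p ≋ padd (pmul (linear t) (syntheticQuotient p)) (pconst (ev p))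
    synthetic-division []      = ≋-sym
      (padd-cong (pmul-zeroʳ (linear t)) 0∷[]≋[])
    synthetic-division (x ∷ p) = begin
      x ∷ p
        ≈⟨ ∷-split x p ⟩
      padd (pconst x) (pmul pX p)
        ≈⟨ padd-cong (≋-refl {pconst x}) (pmul-congˡ pX (synthetic-division p)) ⟩
      padd (pconst x) (pmul pX (padd (pmul (linear t) d) (pconst e)))
        ≈⟨ horner-step R[X] pX (linear t) (pconst t) (pconst x) d (pconst e) X≋ ⟩
      padd (pmul (linear t) (padd (pconst e) (pmul pX d))) (padd (pconst x) (pmul (pconst t) (pconst e)))
        ≈⟨ padd-cong (pmul-congˡ (linear t) (≋-sym (∷-split e d)))
             (padd-cong (≋-refl {pconst x}) (≋-sym (IsHom.*-homo (pconst-isHom R) t e))) ⟩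
      padd (pmul (linear t) (e ∷ d)) (pconst (x + t * e)) ∎
      where
      open SetoidReasoning R[X].setoid
      d = syntheticQuotient p
      e = ev p
      X≋ : pX ≋ padd (linear t) (pconst t)
      X≋ = ≋-sym (begin
        padd (linear t) (pconst t)
          ≈⟨ padd-assoc pX (pneg (pconst t)) (pconst t) ⟩
        padd pX (padd (pneg (pconst t)) (pconst t))
          ≈⟨ padd-cong (≋-refl {pX}) (padd-inverseˡ (pconst t)) ⟩
        padd pX [] ∎)

    factor-theorem : ∀ p → ev p ≈ 0# → p ≋ pmul (linear t) (syntheticQuotient p)
    factor-theorem p root = begin
      p
        ≈⟨ synthetic-division p ⟩
      padd (pmul (linear t) (syntheticQuotient p)) (pconst (ev p))
        ≈⟨ padd-cong (≋-refl {pmul (linear t) (syntheticQuotient p)})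
             (≋-trans (∷-cong root ≋-refl) 0∷[]≋[]) ⟩
      padd (pmul (linear t) (syntheticQuotient p)) []
        ≈⟨ padd-identityʳ _ ⟩
      pmul (linear t) (syntheticQuotient p) ∎
      where open SetoidReasoning R[X].setoid

    -- The k-th coefficient of the quotient is the value at `t` of the part of `p` beyond index k,
    -- which is constant once all higher coefficients vanish. Leaving `x` arbitrary covers the
    -- leading coefficient (`1#`) and those above it (`0#`) at once.
    coeff-syntheticQuotient : ∀ p k {x} → coeff p (suc k) ≈ x →
      (∀ j → suc k < j → coeff p j ≈ 0#) → coeff (syntheticQuotient p) k ≈ x
    coeff-syntheticQuotient []      k       pₖ≈x _ = pₖ≈x
    coeff-syntheticQuotient (y ∷ p) (suc k) pₖ≈x above-k =
      coeff-syntheticQuotient p k pₖ≈x (λ j k<j → above-k (suc j) (s≤s k<j))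
    coeff-syntheticQuotient (y ∷ p) zero {x} p₀≈x above-0 =
      trans (Ev.⟦⟧-cong p≋x) (aeval-pconst (id-isHom R) t x)
      where
      p≋x : p ≋ pconst x
      p≋x = coeffwise λ where
        zero    → p₀≈x
        (suc k) → above-0 (suc (suc k)) (s≤s (s≤s z≤n))

    syntheticQuotient-monic : ∀ {m p} → Monic (suc m) p → Monic m (syntheticQuotient p)
    syntheticQuotient-monic {m} {p} monic = record
      { leading = coeff-syntheticQuotient p m (leading monic) (above monic)
      ; above   = λ k m<k → coeff-syntheticQuotient p k (above monic (suc k) (s≤s m<k))
          (λ j k<j → above monic j (ℕ.<-trans (s≤s m<k) k<j)) }

module _ {a b c d : Level} {R : CommutativeRing a b} {S : CommutativeRing c d}
         {φ : CommutativeRing.Carrier R → CommutativeRing.Carrier S} (φ-hom : IsHom R S φ) where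
  open CommutativeRing S
  open IsHom φ-hom
  open PolynomialRing S
  private
    module MR = MonicPolynomials R
    module MS = MonicPolynomials S

  map-monic : ∀ {m p} → MR.Monic m p → MS.Monic m (map φ p)
  map-monic {m} {p} monic = record
    { leading = trans (coeff-map φ-hom p m) (trans (⟦⟧-cong (MR.leading monic)) 1#-homo)
    ; above   = λ k m<k → trans (coeff-map φ-hom p k) (trans (⟦⟧-cong (MR.above monic k m<k)) 0#-homo) }

  map-X : map φ (PathPoly.pX R) ≋ pX
  map-X = ∷-cong 0#-homo (∷-cong 1#-homo ≋-refl)

  map-linear : ∀ t → map φ (MR.linear t) ≋ MS.linear (φ t)
  map-linear t = ≋-trans (homo-sub (map-isHom φ-hom) (PathPoly.pX R) (PathPoly.pconst R t))
    (padd-cong map-X (≋-refl {pneg (pconst (φ t))}))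

-- Splitting a monic polynomial in an extension ring

-- The levels do not depend on the number of adjoined roots, because `c ⊔ (c ⊔ ℓ)` is `c ⊔ ℓ`.
record SplittingExtension {c ℓ : Level} (R : CommutativeRing c ℓ) (m : ℕ)
                          (g : PathPoly.Poly R) : Set (lsuc (c ⊔ ℓ)) where
  field
    extension : CommutativeRing c (c ⊔ ℓ)
  private
    module R = CommutativeRing R
    module S = CommutativeRing extension
  open PolynomialRing extension
  open MonicPolynomials extension
  field
    embed     : R.Carrier → S.Carrier
    embed-hom : IsHom R extension embed
    injective : ∀ {x y} → embed x S.≈ embed y → x R.≈ y
    roots     : Fin m → S.Carrier
    splits    : map embed g ≋ Chebyshev.∏ R[X] (linear ∘ roots)

module AdjoinRoot {c ℓ : Level} (R : CommutativeRing c ℓ) {m : ℕ} {g : PathPoly.Poly R}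
                  (monic : MonicPolynomials.Monic R (suc m) g) where
  open CommutativeRing R hiding (zero)
  open PolynomialRing R
  open MonicPolynomials R
  open Quotient R[X] g public

  embed-isHom : IsHom R R/⟨g⟩ pconst
  embed-isHom = ∘-isHom (pconst-isHom R) projection-isHom

  -- If two constants differ by `pmul h g`, that product has no coefficient in positive degree.
  -- Since `g` is monic of degree `suc m`, at least 1, cancellation gives h = 0.
  embed-injective : ∀ {x y} → pconst x ∼ pconst y → x ≈ y
  embed-injective {x} {y} (differsBy h x≋y+hg) = begin
    x                                  ≈⟨ coeff≈ x≋y+hg zero ⟩
    coeff (padd (pconst y) (pmul h g)) zero ≈⟨ coeff-padd (pconst y) (pmul h g) zero ⟩
    y + coeff (pmul h g) zero          ≈⟨ +-congˡ (coeff≈ (pmul-cong {h} {[]} {g} h≋[] ≋-refl) zero) ⟩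
    y + 0#                             ≈⟨ +-identityʳ y ⟩
    y                                  ∎
    where
    open SetoidReasoning setoid
    h≋[] : h ≋ []
    h≋[] = monic-cancel monic h λ where
      (suc k) _ → begin
        coeff (pmul h g) (suc k)                     ≈⟨ +-identityˡ _ ⟨
        0# + coeff (pmul h g) (suc k)                ≈⟨ coeff-padd (pconst y) (pmul h g) (suc k) ⟨
        coeff (padd (pconst y) (pmul h g)) (suc k)   ≈⟨ coeff≈ x≋y+hg (suc k) ⟨
        0#                                           ∎

  -- Evaluating at X a polynomial whose coefficients have been made constants gives the polynomial
  -- back, and `g` is zero in the quotient.
  X-is-root : aeval (id-isHom R/⟨g⟩) pX (map pconst g) ∼ []
  X-is-root = ∼-trans (≈⇒∼ (aeval-X≋ g)) g∼0
    where
    aeval-X≋ : ∀ p → aeval (id-isHom R/⟨g⟩) pX (map pconst p) ≋ p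
    aeval-X≋ []      = ≋-refl
    aeval-X≋ (x ∷ p) =
      ≋-trans (padd-cong (≋-refl {pconst x}) (pmul-congˡ pX (aeval-X≋ p))) (≋-sym (∷-split x p))

-- Recursion on the degree with the ring varying: the cofactor of X - root is again monic, of degree
-- `m`, over the ring where the root was adjoined.
splittingExtension : ∀ {c ℓ} (R : CommutativeRing c ℓ) m {g} →
  MonicPolynomials.Monic R m g → SplittingExtension R m g
splittingExtension R zero {g} monic = record
  -- No root is left to adjoin. The quotient by `0#` identifies nothing new; it only lifts equality
  -- to the level `c ⊔ ℓ`.
  { extension = R/⟨g⟩
  ; embed     = id
  ; embed-hom = projection-isHom
  ; injective = λ where
      (differsBy h x≈y+h0) → trans x≈y+h0 (trans (+-congˡ (zeroʳ h)) (+-identityʳ _))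
  ; roots     = λ ()
  ; splits    = coeffwise λ where
      zero    → ∼-trans (coeff-map projection-isHom g zero) (≈⇒∼ (leading monic))
      (suc k) → ∼-trans (coeff-map projection-isHom g (suc k)) (≈⇒∼ (above monic (suc k) (s≤s z≤n)))
  }
  where
  open CommutativeRing R hiding (zero)
  open MonicPolynomials R
  open Quotient R 0#
  open PolynomialRing R/⟨g⟩ using (coeffwise)
splittingExtension {c} {ℓ} R (suc m) {g} monic = record
  { extension = E.extension
  ; embed     = E.embed ∘ pconst
  ; embed-hom = ∘-isHom embed-isHom E.embed-hom
  ; injective = embed-injective ∘ E.injective
  ; roots     = λ where
      zero    → E.embed pX
      (suc i) → E.roots i
  ; splits    = begin
      map (E.embed ∘ pconst) g
        ≡⟨ List.map-∘ g ⟩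
      map E.embed g₁
        ≈⟨ Map.⟦⟧-cong (MonicPolynomials.factor-theorem R/⟨g⟩ pX g₁ X-is-root) ⟩
      map E.embed (PathPoly.pmul R/⟨g⟩ (linear pX) h)
        ≈⟨ Map.*-homo (linear pX) h ⟩
      PathPoly.pmul E.extension (map E.embed (linear pX)) (map E.embed h)
        ≈⟨ CommutativeRing.*-cong S[X] (map-linear E.embed-hom pX) E.splits ⟩
      PathPoly.pmul E.extension (MonicPolynomials.linear E.extension (E.embed pX)) _ ∎
  }
  where
  open PathPoly R using (pX; pconst)
  open AdjoinRoot R monic
  open MonicPolynomials R/⟨g⟩ using (linear; syntheticQuotient; syntheticQuotient-monic)
  g₁ = map pconst g
  h  = syntheticQuotient pX g₁
  module E = SplittingExtension (splittingExtension R/⟨g⟩ m {h}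
    (syntheticQuotient-monic pX (map-monic embed-isHom monic)))
  module Map = IsHom (map-isHom E.embed-hom)
  S[X] = PolynomialRing.R[X] E.extension
  open SetoidReasoning (CommutativeRing.setoid S[X])

-- Determinants and the recurrence for the path polynomials

module Determinants {c ℓ : Level} (R : CommutativeRing c ℓ) where
  open CommutativeRing R hiding (zero)
  open DetOver _+_ _*_ -_ 0# 1#
  open RingProperties ring using (-1*x≈-x)
  open SetoidReasoning setoid

  sumFin-cong : ∀ {n} {f g : Fin n → Carrier} → (∀ i → f i ≈ g i) → sumFin f ≈ sumFin g
  sumFin-cong {zero}  f≈g = refl
  sumFin-cong {suc n} f≈g = +-cong (f≈g zero) (sumFin-cong (λ i → f≈g (suc i)))

  det-cong : ∀ n {M N : Fin n → Fin n → Carrier} → (∀ i k → M i k ≈ N i k) → det n M ≈ det n N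
  det-cong zero    M≈N = refl
  det-cong (suc n) M≈N = sumFin-cong {suc n} λ j →
    *-cong (*-congˡ {signA (toℕ j)} (M≈N zero j)) (det-cong n (λ i k → M≈N (suc i) (punchIn j k)))

  sumFin-zero : ∀ {n} (f : Fin n → Carrier) → (∀ i → f i ≈ 0#) → sumFin f ≈ 0#
  sumFin-zero {zero}  f f≈0 = refl
  sumFin-zero {suc n} f f≈0 =
    trans (+-cong (f≈0 zero) (sumFin-zero (λ i → f (suc i)) (λ i → f≈0 (suc i)))) (+-identityˡ 0#)

  -- In the expansion along the first row, the term of column 0 has a zero entry; deleting any later
  -- column leaves the zero column in first place, so the other minors vanish by induction.
  det-zeroColumn : ∀ n (M : Fin (suc n) → Fin (suc n) → Carrier) →
    (∀ i → M i zero ≈ 0#) → det (suc n) M ≈ 0#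
  det-zeroColumn n M column≈0 = sumFin-zero {suc n} _ (term n M column≈0)
    where
    term : ∀ n (M : Fin (suc n) → Fin (suc n) → Carrier) → (∀ i → M i zero ≈ 0#) → ∀ j →
      signA (toℕ j) * M zero j * det n (λ i k → M (suc i) (punchIn j k)) ≈ 0#
    term n       M column≈0 zero    =
      trans (*-congʳ (trans (*-congˡ (column≈0 zero)) (zeroʳ _))) (zeroˡ _)
    term (suc n) M column≈0 (suc j) =
      trans (*-congˡ (det-zeroColumn n (λ i k → M (suc i) (punchIn (suc j) k))
                       (λ i → column≈0 (suc i)))) (zeroʳ _)

  -- The first row leaves two terms. The minor of the second, `N`, is expanded once more: apart from
  -- the leading term, all its minors keep a zero first column.
  det-tridiagonal : ∀ n (M : Fin (suc (suc n)) → Fin (suc (suc n)) → Carrier) →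
    (∀ k → M zero (suc (suc k)) ≈ 0#) → (∀ i → M (suc (suc i)) zero ≈ 0#) →
    det (suc (suc n)) M ≈
      M zero zero * det (suc n) (λ i k → M (suc i) (suc k))
      - M zero (suc zero) * (M (suc zero) zero * det n (λ i k → M (suc (suc i)) (suc (suc k))))
  det-tridiagonal n M row≈0 column≈0 =
    +-cong (*-congʳ (*-identityˡ _))
      (trans (+-cong second
          (sumFin-zero {n} _ λ k → trans (*-congʳ (trans (*-congˡ (row≈0 k)) (zeroʳ _))) (zeroˡ _)))
        (+-identityʳ _))
    where
    N : Fin (suc n) → Fin (suc n) → Carrier
    N i k = M (suc i) (punchIn (suc zero) k)
    det-N : det (suc n) N ≈ M (suc zero) zero * det n (λ i k → M (suc (suc i)) (suc (suc k)))
    det-N = trans (+-cong (*-congʳ (*-identityˡ _)) (sumFin-zero {n} _ (later n N column≈0)))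
                  (+-identityʳ _)
      where
      later : ∀ n (N : Fin (suc n) → Fin (suc n) → Carrier) → (∀ i → N (suc i) zero ≈ 0#) → ∀ j →
        signA (suc (toℕ j)) * N zero (suc j) * det n (λ i k → N (suc i) (punchIn (suc j) k)) ≈ 0#
      later (suc n) N column≈0 j =
        trans (*-congˡ (det-zeroColumn n (λ i k → N (suc i) (punchIn (suc j) k)) column≈0)) (zeroʳ _)
    second : - 1# * M zero (suc zero) * det (suc n) N ≈
      - (M zero (suc zero) * (M (suc zero) zero * det n (λ i k → M (suc (suc i)) (suc (suc k)))))
    second = begin
      - 1# * M zero (suc zero) * det (suc n) N   ≈⟨ *-assoc _ _ _ ⟩
      - 1# * (M zero (suc zero) * det (suc n) N) ≈⟨ -1*x≈-x _ ⟩
      - (M zero (suc zero) * det (suc n) N)      ≈⟨ -‿cong (*-congˡ det-N) ⟩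
      - (M zero (suc zero) * (M (suc zero) zero * det n (λ i k → M (suc (suc i)) (suc (suc k))))) ∎

module PathPolynomial {c ℓ : Level} (R : CommutativeRing c ℓ) where
  open CommutativeRing R hiding (zero)
  open PolynomialRing R
  open Chebyshev R[X] using (cheb)
  private module R[X] = CommutativeRing R[X]
  open Determinants R[X] using (det-cong; det-tridiagonal)

  charMat-00≋-X : ∀ n → charMat (suc n) zero zero ≋ pneg pX
  charMat-00≋-X n = ∷-cong (+-identityˡ _) ≋-refl

  -- The `does` components of the two decisions agree by computation, although `⌊_⌋` applied to them
  -- does not reduce.
  ≟-suc : ∀ m n → ⌊ suc m ℕ.≟ suc n ⌋ ≡ ⌊ m ℕ.≟ n ⌋
  ≟-suc m n = ≡.trans (isYes≗does (suc m ℕ.≟ suc n)) (≡.sym (isYes≗does (m ℕ.≟ n)))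

  -- Entries depend only on the difference of the indices: deleting the first vertex of a path
  -- leaves a path.
  charMat-suc : ∀ {n} (i k : Fin n) → charMat (suc n) (suc i) (suc k) ≡ charMat n i k
  charMat-suc i k = ≡.cong₂ (λ a d → padd (pconst (b2r a)) (if d then pneg pX else []))
    (≡.cong₂ _∨_ (≟-suc (toℕ i) (suc (toℕ k))) (≟-suc (toℕ k) (suc (toℕ i))))
    (≟-suc (toℕ i) (toℕ k))

  charMat-minor : ∀ n → pdet n (λ i k → charMat (suc n) (suc i) (suc k)) ≋ q n
  charMat-minor n = det-cong n (λ i k → R[X].reflexive (charMat-suc i k))

  charMat-minor₂ : ∀ n → pdet n (λ i k → charMat (suc (suc n)) (suc (suc i)) (suc (suc k))) ≋ q n
  charMat-minor₂ n = ≋-trans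
    (det-cong n (λ i k → R[X].reflexive (charMat-suc (suc i) (suc k)))) (charMat-minor n)

  q≋cheb : ∀ n → q n ≋ cheb (pneg pX) n
  q≋cheb zero          = ≋-refl
  q≋cheb (suc zero)    = begin
    padd (pmul (pmul (pconst 1#) (charMat 1 zero zero)) (pconst 1#)) []
      ≈⟨ padd-identityʳ _ ⟩
    pmul (pmul (pconst 1#) (charMat 1 zero zero)) (pconst 1#)
      ≈⟨ R[X].*-identityʳ (pmul (pconst 1#) (charMat 1 zero zero)) ⟩
    pmul (pconst 1#) (charMat 1 zero zero)
      ≈⟨ pmul-identityˡ (charMat 1 zero zero) ⟩
    charMat 1 zero zero
      ≈⟨ charMat-00≋-X 0 ⟩
    pneg pX ∎
    where open SetoidReasoning R[X].setoid
  q≋cheb (suc (suc n)) = begin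
    q (suc (suc n))
      -- Entries away from the three diagonals are the list `0# ∷ []`, which is zero only up to `≋`.
      ≈⟨ det-tridiagonal n (charMat (suc (suc n))) (λ _ → 0∷[]≋[]) (λ _ → 0∷[]≋[]) ⟩
    padd (pmul (charMat (suc (suc n)) zero zero)
               (pdet (suc n) (λ i k → charMat (suc (suc n)) (suc i) (suc k))))
         (pneg (pmul (pconst 1#) (pmul (pconst 1#)
               (pdet n (λ i k → charMat (suc (suc n)) (suc (suc i)) (suc (suc k)))))))
      ≈⟨ padd-cong
           (pmul-cong (charMat-00≋-X (suc n)) (≋-trans (charMat-minor (suc n)) (q≋cheb (suc n))))
           (pneg-cong (≋-trans (pmul-identityˡ (pmul (pconst 1#) _))
             (≋-trans (pmul-identityˡ _) (≋-trans (charMat-minor₂ n) (q≋cheb n))))) ⟩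
    cheb (pneg pX) (suc (suc n)) ∎
    where open SetoidReasoning R[X].setoid

-- Arithmetic of exponents and greatest common divisors

-- This is n (n + 1) / 2, in additive form because each step of the induction for R(n, n + 1) adds
-- its index to the exponent.
triangular : ℕ → ℕ
triangular zero    = zero
triangular (suc n) = suc n ℕ.+ triangular n

triangular-double : ∀ n → n ℕ.* suc n ≡ triangular n ℕ.+ triangular n
triangular-double zero    = ≡.refl
triangular-double (suc n) = begin
  suc n ℕ.* suc (suc n)                                   ≡⟨ ℕ.*-suc (suc n) (suc n) ⟩
  suc n ℕ.+ (suc n ℕ.+ n ℕ.* suc n)                       ≡⟨ ≡.cong (λ k → suc n ℕ.+ (suc n ℕ.+ k)) (triangular-double n) ⟩
  suc n ℕ.+ (suc n ℕ.+ (triangular n ℕ.+ triangular n)) ≡⟨ ≡.cong (suc n ℕ.+_) (ℕ.+-assoc (suc n) _ _) ⟨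
  suc n ℕ.+ (triangular (suc n) ℕ.+ triangular n)       ≡⟨ ≡.cong (suc n ℕ.+_) (ℕ.+-comm (triangular (suc n)) _) ⟩
  suc n ℕ.+ (triangular n ℕ.+ triangular (suc n))       ≡⟨ ℕ.+-assoc (suc n) _ _ ⟨
  triangular (suc n) ℕ.+ triangular (suc n)             ∎
  where open ≡.≡-Reasoning

[a+a+b]/2≡a+b/2 : ∀ a b → (a ℕ.+ a ℕ.+ b) / 2 ≡ a ℕ.+ b / 2
[a+a+b]/2≡a+b/2 a b = begin
  (a ℕ.+ a ℕ.+ b) / 2     ≡⟨ ≡.cong (λ k → (k ℕ.+ b) / 2) a+a≡a*2 ⟩
  (a ℕ.* 2 ℕ.+ b) / 2       ≡⟨ +-distrib-/-∣ˡ b (divides a ≡.refl) ⟩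
  a ℕ.* 2 / 2 ℕ.+ b / 2     ≡⟨ ≡.cong (ℕ._+ b / 2) (m*n/n≡m a 2) ⟩
  a ℕ.+ b / 2             ∎
  where
  open ≡.≡-Reasoning
  a+a≡a*2 : a ℕ.+ a ≡ a ℕ.* 2
  a+a≡a*2 = ≡.trans (≡.cong (a ℕ.+_) (≡.sym (ℕ.+-identityʳ a))) (ℕ.*-comm 2 a)

even-or-odd : ∀ n → 2 ∣ n ⊎ 2 ∣ suc n
even-or-odd zero    = inj₁ (2 ∣0)
even-or-odd (suc n) with even-or-odd n
... | inj₁ 2∣n   = inj₂ (∣m∣n⇒∣m+n (∣-refl {2}) 2∣n)
... | inj₂ 2∣1+n = inj₁ 2∣1+n

-- If n and m were both odd, 2 would divide both successors. This removes the sign (-1)^(n m) from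
-- the exchange.
coprime-suc⇒even-product : ∀ n m → gcd (1 ℕ.+ n) (1 ℕ.+ m) ≡ 1 → 2 ∣ n ℕ.* m
coprime-suc⇒even-product n m coprime with even-or-odd n | even-or-odd m
... | inj₁ 2∣n   | _          = ∣m⇒∣m*n m 2∣n
... | inj₂ _     | inj₁ 2∣m   = ∣n⇒∣m*n n 2∣m
... | inj₂ 2∣1+n | inj₂ 2∣1+m =
  contradiction (∣1⇒≡1 (≡.subst (2 ∣_) coprime (gcd-greatest 2∣1+n 2∣1+m))) λ ()

gcd-+ˡ : ∀ a b → gcd a (a ℕ.+ b) ≡ gcd a b
gcd-+ˡ a b = ∣-antisym
  (gcd-greatest (gcd[m,n]∣m a (a ℕ.+ b)) (∣m+n∣m⇒∣n (gcd[m,n]∣n a (a ℕ.+ b)) (gcd[m,n]∣m a (a ℕ.+ b))))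
  (gcd-greatest (gcd[m,n]∣m a b) (∣m∣n⇒∣m+n (gcd[m,n]∣m a b) (gcd[m,n]∣n a b)))

-- Resultants of two Chebyshev polynomials

module _ {c ℓ : Level} (R : CommutativeRing c ℓ) where
  open CommutativeRing R using (Carrier; _≈_; 0#)
  open PolynomialRing R
  open MonicPolynomials R using (linear)
  open Chebyshev

  -- A factorisation is required, not merely n roots: over a ring with zero divisors, roots alone
  -- would not give the product formula.
  record ChebSplits (n : ℕ) (ν : Fin n → Carrier) : Set ℓ where
    constructor splitsAs
    field factorisation : cheb R[X] pX n ≋ ∏ R[X] (linear ∘ ν)

  -- Intended for `x` the product of `cheb (ν i) m` over the roots ν of the monic `cheb X n`, which
  -- is the resultant of `cheb X n` and `cheb X m`.
  IsChebResultant : ℕ → ℕ → Carrier → Set ℓ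
  IsChebResultant n m x =
    (gcd (1 ℕ.+ n) (1 ℕ.+ m) ≢ 1 → x ≈ 0#) ×
    (gcd (1 ℕ.+ n) (1 ℕ.+ m) ≡ 1 → x ≈ minusOnePow ((n ℕ.* m) / 2))

module _ {a b c d : Level} {R : CommutativeRing a b} {S : CommutativeRing c d}
         {φ : CommutativeRing.Carrier R → CommutativeRing.Carrier S} (φ-hom : IsHom R S φ) where
  private
    module R = CommutativeRing R
    open PolynomialRing R
    open MonicPolynomials R using (linear)
    module CX = Chebyshev R[X]
  open CommutativeRing S
  open Chebyshev S
  open SetoidReasoning setoid

  -- The factorisation is evaluated at `y`, which may lie in a larger ring than the roots; the
  -- exchange needs this for the roots already present in the base ring.
  cheb-as-product : ∀ {n} {ν : Fin n → R.Carrier} → ChebSplits R n ν → ∀ y →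
    cheb y n ≈ ∏ (λ i → y - φ (ν i))
  cheb-as-product {n} {ν} splits y = begin
    cheb y n                     ≈⟨ cheb-cong (aeval-X φ-hom y) n ⟨
    cheb (ev pX) n               ≈⟨ homo-cheb (aeval-isHom φ-hom y) pX n ⟨
    ev (CX.cheb pX n)            ≈⟨ Ev.⟦⟧-cong (ChebSplits.factorisation splits) ⟩
    ev (CX.∏ (linear ∘ ν))       ≈⟨ homo-∏ (aeval-isHom φ-hom y) (linear ∘ ν) ⟩
    ∏ (λ i → ev (linear (ν i)))  ≈⟨ ∏-cong (λ i → trans (homo-sub (aeval-isHom φ-hom y) pX (pconst (ν i)))
                                      (+-cong (aeval-X φ-hom y) (-‿cong (aeval-pconst φ-hom y (ν i))))) ⟩
    ∏ (λ i → y - φ (ν i))        ∎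
    where
    ev = aeval φ-hom y
    module Ev = IsHom (aeval-isHom φ-hom y)

cheb-root : ∀ {c ℓ} (R : CommutativeRing c ℓ) {n ν} → ChebSplits R n ν →
  let open CommutativeRing R using (_≈_; 0#) in
  ∀ i → Chebyshev.cheb R (ν i) n ≈ 0#
cheb-root R {n} {ν} splits i = trans (cheb-as-product (id-isHom R) splits (ν i))
  (Chebyshev.∏-vanishes R (λ j → ν i - ν j) i (-‿inverseʳ (ν i)))
  where open CommutativeRing R

module Exchange {c ℓ : Level} (R : CommutativeRing c ℓ) {n : ℕ}
                {ν : Fin n → CommutativeRing.Carrier R} (ν-splits : ChebSplits R n ν) (m : ℕ) where
  open SplittingExtension (splittingExtension R m (MonicPolynomials.cheb-monic R m)) public
    using (extension; embed; embed-hom; injective; roots)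
    renaming (splits to embed-splits)
  private module R = Chebyshev R
  open CommutativeRing extension
  open Chebyshev extension
  open PathPoly extension using (minusOnePow)
  open PolynomialRing using (R[X]; ≋-trans; ≋-sym)
  open SetoidReasoning setoid

  roots-split : ChebSplits extension m roots
  roots-split = splitsAs (≋-trans extension
    (S[X].trans (S[X].sym (Chebyshev.cheb-cong (R[X] extension) (map-X embed-hom) m))
      (S[X].sym (homo-cheb (map-isHom embed-hom) (PathPoly.pX R) m)))
    embed-splits)
    where module S[X] = CommutativeRing (R[X] extension)

  -- Only `cheb X m` receives new roots; those of `cheb X n` are carried along by `embed`. Both
  -- sides become double products of differences.
  exchange : embed (R.∏ (λ i → R.cheb (ν i) m)) ≈
    minusOnePow (n ℕ.* m) * ∏ (λ j → cheb (roots j) n)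
  exchange = begin
    embed (R.∏ (λ i → R.cheb (ν i) m))
      ≈⟨ homo-∏ embed-hom (λ i → R.cheb (ν i) m) ⟩
    ∏ (λ i → embed (R.cheb (ν i) m))
      ≈⟨ ∏-cong (λ i → trans (homo-cheb embed-hom (ν i) m)
                         (cheb-as-product (id-isHom extension) roots-split (embed (ν i)))) ⟩
    ∏ (λ i → ∏ (λ j → embed (ν i) - roots j))
      ≈⟨ ∏-reciprocity (embed ∘ ν) roots ⟩
    minusOnePow (n ℕ.* m) * ∏ (λ j → ∏ (λ i → roots j - embed (ν i)))
      ≈⟨ *-congˡ (∏-cong (λ j → cheb-as-product embed-hom ν-splits (roots j))) ⟨
    minusOnePow (n ℕ.* m) * ∏ (λ j → cheb (roots j) n) ∎

-- At a root of `cheb X (suc n)` the recurrence reduces `cheb (suc (suc n))` to `- cheb n`.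
-- Exchanging the resulting R(n + 1, n) into R(n, n + 1) costs the sign (-1)^(n (n + 1)) = 1, and
-- the induction hypothesis is applied over the extension.
∏-cheb-successor : ∀ n {c ℓ} (R : CommutativeRing c ℓ) {ν} → ChebSplits R n ν →
  let open CommutativeRing R using (_≈_); open Chebyshev R in
  ∏ (λ i → cheb (ν i) (suc n)) ≈ PathPoly.minusOnePow R (triangular n)
∏-cheb-successor zero    R splits = CommutativeRing.refl R
∏-cheb-successor (suc n) R {ν} splits = begin
  ∏ (λ i → cheb (ν i) (suc (suc n)))
    ≈⟨ ∏-cong at-root ⟩
  ∏ (λ i → - cheb (ν i) n)
    ≈⟨ ∏-neg (λ i → cheb (ν i) n) ⟩
  minusOnePow (suc n) * ∏ (λ i → cheb (ν i) n)
    ≈⟨ *-congˡ predecessor ⟩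
  minusOnePow (suc n) * minusOnePow (triangular n)
    ≈⟨ sgn-+ (suc n) (triangular n) ⟨
  minusOnePow (triangular (suc n)) ∎
  where
  open CommutativeRing R
  open Chebyshev R
  open PathPoly R using (minusOnePow)
  open SetoidReasoning setoid
  open Exchange R splits n
  at-root : ∀ i → cheb (ν i) (suc (suc n)) ≈ - cheb (ν i) n
  at-root i = trans (+-congʳ (trans (*-congˡ (cheb-root R splits i)) (zeroʳ (ν i)))) (+-identityˡ _)
  predecessor : ∏ (λ i → cheb (ν i) n) ≈ minusOnePow (triangular n)
  predecessor = injective (S.trans exchange (S.trans
    (S.*-cong (S.trans (S.reflexive (≡.cong sgnS n+n-even)) (CS.sgn-double (triangular n)))
              (∏-cheb-successor n extension roots-split))
    (S.trans (S.*-identityˡ _) (S.sym (homo-sgn embed-hom (triangular n))))))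
    where
    module S = CommutativeRing extension
    module CS = Chebyshev extension
    sgnS = PathPoly.minusOnePow extension
    n+n-even : suc n ℕ.* n ≡ triangular n ℕ.+ triangular n
    n+n-even = ≡.trans (ℕ.*-comm (suc n) n) (triangular-double n)

module _ {c ℓ : Level} (R : CommutativeRing c ℓ) where
  open CommutativeRing R hiding (zero)
  open Chebyshev R
  open PathPoly R using (minusOnePow)
  open SetoidReasoning setoid

  chebResultant-diagonal : ∀ n {ν} → ChebSplits R n ν →
    IsChebResultant R n n (∏ (λ i → cheb (ν i) n))
  -- The product is empty, and the gcd of 1 and 1 is 1.
  chebResultant-diagonal zero    splits = (λ gcd≢1 → contradiction ≡.refl gcd≢1) , λ _ → refl
  chebResultant-diagonal (suc n) {ν} splits =
    (λ _ → ∏-vanishes (λ i → cheb (ν i) (suc n)) zero (cheb-root R splits zero)) ,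
    λ gcd≡1 → contradiction
      (∣1⇒≡1 (≡.subst (2 ℕ.+ n ∣_) gcd≡1 (gcd-greatest ∣-refl ∣-refl))) λ ()

  chebResultant-shift : ∀ n k {ν} → ChebSplits R n ν →
    IsChebResultant R n k (∏ (λ i → cheb (ν i) k)) →
    IsChebResultant R n (suc n ℕ.+ k) (∏ (λ i → cheb (ν i) (suc n ℕ.+ k)))
  chebResultant-shift n k {ν} splits (vanishing , coprime) =
    (λ gcd≢1 → trans factorised
      (trans (*-congˡ (vanishing (gcd≢1 ∘ ≡.trans gcd-shift))) (zeroʳ _))) ,
    λ gcd≡1 → begin
      ∏ (λ i → cheb (ν i) (suc n ℕ.+ k))
        ≈⟨ factorised ⟩
      minusOnePow (triangular n) * ∏ (λ i → cheb (ν i) k)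
        ≈⟨ *-congˡ (coprime (≡.trans (≡.sym gcd-shift) gcd≡1)) ⟩
      minusOnePow (triangular n) * minusOnePow ((n ℕ.* k) / 2)
        ≈⟨ sgn-+ (triangular n) _ ⟨
      minusOnePow (triangular n ℕ.+ (n ℕ.* k) / 2)
        ≡⟨ ≡.cong minusOnePow exponent ⟨
      minusOnePow ((n ℕ.* (suc n ℕ.+ k)) / 2) ∎
    where
    gcd-shift : gcd (1 ℕ.+ n) (1 ℕ.+ (suc n ℕ.+ k)) ≡ gcd (1 ℕ.+ n) (1 ℕ.+ k)
    gcd-shift = ≡.trans (≡.cong (gcd (1 ℕ.+ n)) (≡.sym (ℕ.+-suc (suc n) k))) (gcd-+ˡ (1 ℕ.+ n) (1 ℕ.+ k))
    factorised : ∏ (λ i → cheb (ν i) (suc n ℕ.+ k)) ≈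
      minusOnePow (triangular n) * ∏ (λ i → cheb (ν i) k)
    factorised = begin
      ∏ (λ i → cheb (ν i) (suc n ℕ.+ k))
        ≈⟨ ∏-cong (λ i → cheb-shift (ν i) n (cheb-root R splits i) k) ⟩
      ∏ (λ i → cheb (ν i) (suc n) * cheb (ν i) k)
        ≈⟨ ∏-distrib-* (λ i → cheb (ν i) (suc n)) (λ i → cheb (ν i) k) ⟩
      ∏ (λ i → cheb (ν i) (suc n)) * ∏ (λ i → cheb (ν i) k)
        ≈⟨ *-congʳ (∏-cheb-successor n R splits) ⟩
      minusOnePow (triangular n) * ∏ (λ i → cheb (ν i) k) ∎
    exponent : (n ℕ.* (suc n ℕ.+ k)) / 2 ≡ triangular n ℕ.+ (n ℕ.* k) / 2
    exponent = ≡.trans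
      (≡.cong (_/ 2) (≡.trans (ℕ.*-distribˡ-+ n (suc n) k) (≡.cong (ℕ._+ n ℕ.* k) (triangular-double n))))
      ([a+a+b]/2≡a+b/2 (triangular n) (n ℕ.* k))

  -- The sign (-1)^(n m) multiplies zero if the successors have a common factor, and is 1 if they
  -- are coprime.
  chebResultant-exchange : ∀ n m {ν} (splits : ChebSplits R n ν) →
    let open Exchange R splits m in
    IsChebResultant extension m n
      (Chebyshev.∏ extension (λ j → Chebyshev.cheb extension (roots j) n)) →
    IsChebResultant R n m (∏ (λ i → cheb (ν i) m))
  chebResultant-exchange n m {ν} splits (vanishing , coprime) =
    (λ gcd≢1 → injective (S.trans exchange (S.trans
      (S.*-congˡ (vanishing (gcd≢1 ∘ ≡.trans (gcd-comm (1 ℕ.+ n) (1 ℕ.+ m)))))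
      (S.trans (S.zeroʳ _) (S.sym (IsHom.0#-homo embed-hom)))))) ,
    λ gcd≡1 → injective (S.trans exchange (S.trans
      (S.*-cong (even-sgn (coprime-suc⇒even-product n m gcd≡1))
                (coprime (≡.trans (gcd-comm (1 ℕ.+ m) (1 ℕ.+ n)) gcd≡1)))
      (S.trans (S.*-identityˡ _)
        (S.trans (S.reflexive (≡.cong (λ k → sgnS (k / 2)) (ℕ.*-comm m n)))
          (S.sym (homo-sgn embed-hom ((n ℕ.* m) / 2)))))))
    where
    open Exchange R splits m
    module S = CommutativeRing extension
    sgnS = PathPoly.minusOnePow extension
    even-sgn : ∀ {k} → 2 ∣ k → sgnS k S.≈ S.1#
    even-sgn (divides e ≡.refl) = S.trans
      (S.reflexive (≡.cong sgnS (≡.trans (ℕ.*-comm e 2) (≡.cong (e ℕ.+_) (ℕ.+-identityʳ e)))))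
      (Chebyshev.sgn-double extension e)

-- The Euclidean algorithm

-- `fuel` bounds n + m. An exchange preserves the sum, so it happens inside a single unit of fuel;
-- the lowering from `suc n ℕ.+ k` to `k` decreases it by n + 1 and pays for the next unit.
chebResultant : ∀ fuel {c ℓ} (R : CommutativeRing c ℓ) n m → n ℕ.+ m < fuel → ∀ {ν} →
  ChebSplits R n ν →
  let open Chebyshev R in IsChebResultant R n m (∏ (λ i → cheb (ν i) m))
chebResultant-≤ : ∀ fuel {c ℓ} (R : CommutativeRing c ℓ) n m → n ≤ m → n ℕ.+ m ≤ fuel → ∀ {ν} →
  ChebSplits R n ν →
  let open Chebyshev R in IsChebResultant R n m (∏ (λ i → cheb (ν i) m))

chebResultant (suc fuel) R n m (s≤s n+m≤fuel) splits with n ℕ.≤? m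
... | yes n≤m = chebResultant-≤ fuel R n m n≤m n+m≤fuel splits
... | no  n≰m = chebResultant-exchange R n m splits
  (chebResultant-≤ fuel extension m n (ℕ.<⇒≤ (ℕ.≰⇒> n≰m))
    (≡.subst (_≤ fuel) (ℕ.+-comm n m) n+m≤fuel) roots-split)
  where open Exchange R splits m

chebResultant-≤ fuel R n m n≤m n+m≤fuel splits with ℕ.m≤n⇒m<n∨m≡n n≤m
... | inj₂ ≡.refl = chebResultant-diagonal R n splits
-- Here m = n + 1 + k, so one Euclidean step on the successors subtracts n + 1 from m + 1.
... | inj₁ n<m with m ℕ.∸ suc n | ℕ.m+[n∸m]≡n n<m
...   | k | ≡.refl = chebResultant-shift R n k splits
  (chebResultant fuel R n k (ℕ.≤-trans (ℕ.m≤n+m (suc (n ℕ.+ k)) n) n+m≤fuel) splits)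

-- Return to the path polynomials and their roots

module _ {c ℓ : Level} (R : CommutativeRing c ℓ) where
  open CommutativeRing R hiding (zero)
  open PolynomialRing R
  open MonicPolynomials R using (linear)
  open Chebyshev
  private
    module R[X] = CommutativeRing R[X]
    open RingProperties R[X].ring using (-‿involutive)

  prodFin≡∏ : ∀ {n} (f : Fin n → Carrier) → prodFin f ≡ ∏ R f
  prodFin≡∏ {zero}  f = ≡.refl
  prodFin≡∏ {suc n} f = ≡.cong (f zero *_) (prodFin≡∏ (f ∘ suc))

  pprodFin≡∏ : ∀ {n} (f : Fin n → Poly) → pprodFin f ≡ ∏ R[X] f
  pprodFin≡∏ {zero}  f = ≡.refl
  pprodFin≡∏ {suc n} f = ≡.cong (pmul (f zero)) (pprodFin≡∏ (f ∘ suc))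

  eval-q : ∀ m t → eval (q m) t ≈ cheb R (- t) m
  eval-q m t = begin
    eval (q m) t                  ≈⟨ Ev.⟦⟧-cong (PathPolynomial.q≋cheb R m) ⟩
    eval (cheb R[X] (pneg pX) m) t ≈⟨ homo-cheb ev-isHom (pneg pX) m ⟩
    cheb R (eval (pneg pX) t) m   ≈⟨ cheb-cong R (trans (Ev.-‿homo pX) (-‿cong (aeval-X (id-isHom R) t))) m ⟩
    cheb R (- t) m                ∎
    where
    open SetoidReasoning setoid
    ev-isHom = aeval-isHom (id-isHom R) t
    module Ev = IsHom ev-isHom

  -- Substituting - X for X turns the factors λᵢ - X into the monic factors X - (- λᵢ).
  negated-roots-split : ∀ {n} (lam : Fin n → Carrier) →
    q n ≈ₚ pprodFin (λ i → padd (pconst (lam i)) (pneg pX)) →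
    ChebSplits R n (λ i → - lam i)
  negated-roots-split {n} lam q≈∏ = splitsAs (begin
    cheb R[X] pX n
      ≈⟨ cheb-cong R[X] (≋-trans σ-neg (-‿involutive pX)) n ⟨
    cheb R[X] (σ (pneg pX)) n
      ≈⟨ homo-cheb σ-isHom (pneg pX) n ⟨
    σ (cheb R[X] (pneg pX) n)
      ≈⟨ Subst.⟦⟧-cong (PathPolynomial.q≋cheb R n) ⟨
    σ (q n)
      ≈⟨ Subst.⟦⟧-cong (≋-trans (coeffwise {q n} q≈∏) (R[X].reflexive (pprodFin≡∏ factor))) ⟩
    σ (∏ R[X] factor)
      ≈⟨ homo-∏ σ-isHom factor ⟩
    ∏ R[X] (σ ∘ factor)
      ≈⟨ ∏-cong R[X] (λ i → begin
           σ (factor i)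
             ≈⟨ Subst.+-homo (pconst (lam i)) (pneg pX) ⟩
           padd (σ (pconst (lam i))) (σ (pneg pX))
             ≈⟨ padd-cong (≋-trans (aeval-pconst (pconst-isHom R) (pneg pX) (lam i))
                                   (≋-sym (-‿involutive (pconst (lam i)))))
                          (≋-trans σ-neg (-‿involutive pX)) ⟩
           padd (pneg (pconst (- lam i))) pX
             ≈⟨ padd-comm (pneg (pconst (- lam i))) pX ⟩
           linear (- lam i) ∎) ⟩
    ∏ R[X] (linear ∘ (λ i → - lam i)) ∎)
    where
    open SetoidReasoning R[X].setoid
    σ = aeval (pconst-isHom R) (pneg pX)
    σ-isHom = aeval-isHom (pconst-isHom R) (pneg pX)
    module Subst = IsHom σ-isHom
    factor : Fin n → Poly
    factor i = padd (pconst (lam i)) (pneg pX)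
    σ-neg : σ (pneg pX) ≋ pneg (pneg pX)
    σ-neg = ≋-trans (Subst.-‿homo pX) (pneg-cong (aeval-X (pconst-isHom R) (pneg pX)))

open import Data.Nat using (_*_)

theorem6 : {c ℓ : Level} (R : CommutativeRing c ℓ) (n m : ℕ) → 1 ≤ n → 1 ≤ m →
    (lam : Fin n → CommutativeRing.Carrier R) →
    PathPoly._≈ₚ_ R (PathPoly.q R n)
    (PathPoly.pprodFin R (λ i → PathPoly.padd R (PathPoly.pconst R (lam i)) (PathPoly.pneg R (PathPoly.pX R)))) →
    (gcd (1 Data.Nat.+ n) (1 Data.Nat.+ m) ≢ 1 →
    CommutativeRing._≈_ R (PathPoly.prodFin R (λ i → PathPoly.eval R (PathPoly.q R m) (lam i))) (CommutativeRing.0# R))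
    × (gcd (1 Data.Nat.+ n) (1 Data.Nat.+ m) ≡ 1 →
    CommutativeRing._≈_ R (PathPoly.prodFin R (λ i → PathPoly.eval R (PathPoly.q R m) (lam i))) (PathPoly.minusOnePow R ((n * m) / 2)))
theorem6 R n m _ _ lam q≈∏ = trans ∏≈ ∘ proj₁ value , trans ∏≈ ∘ proj₂ value
  where
  open CommutativeRing R using (_≈_; -_; trans; reflexive)
  open PathPoly R using (prodFin; eval; q)
  open Chebyshev R
  value : IsChebResultant R n m (∏ (λ i → cheb (- lam i) m))
  value = chebResultant (suc (n Data.Nat.+ m)) R n m ℕ.≤-refl (negated-roots-split R lam q≈∏)
  ∏≈ : prodFin (λ i → eval (q m) (lam i)) ≈ ∏ (λ i → cheb (- lam i) m)
  ∏≈ = trans (reflexive (prodFin≡∏ R (λ i → eval (q m) (lam i)))) (∏-cong (λ i → eval-q R m (lam i)))
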